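{- For every $H\in\mathcal C$, the predominated graph $(H,V(H)\setminus X(H))$ is an atomic MBD critical graph.
   Context: For a tree $T$, $S(T)$ is obtained by subdividing each edge of $T$ exactly once; $\mathcal S=\{S(T):T\text{ a tree}\}$ and $X(S(T))=V(T)$ (with $S(P_1)=P_1$, $X(P_1)=V(P_1)$). The double-odd replacement of an edge $xy$ of a graph removes $xy$ and adds two internally vertex-disjoint $x,y$-paths, both of odd length (if both have length $1$ this is the same as keeping the single edge $xy$). For $F\in\mathcal S$, an $F$-cactus is a cactus graph $H$ that is either $F$ or obtained from $F$ by double-odd replacements of some edges of $F$; $H$ is bipartite and $X(H)$ is the bipartition class of $H$ containing $X(F)$. $\mathcal C$ is the set of all $F$-cacti over all $F\in\mathcal S$. A predominated graph is a pair $(G,D)$ with $D\subseteq V(G)$; in the MBD game on $(G,D)$, Staller and Dominator alternately claim unclaimed vertices of $V(G)$ (including vertices of $D$), Staller first, until all are claimed; Staller wins if she claims all of $N_G[v]$ for some $v\in V(G)\setminus D$, Dominator wins otherwise. $(G,D)$ is MBD critical if Staller wins on $(G,D)$ but Dominator wins on $(G,D\cup\{v\})$ for every $v\in V(G)\setminus D$; it is atomic MBD critical if moreover $D$ is independent in $G$ and no vertex of $D$ is isolated in $G$. -}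

module Defs where

open import Level using (0ℓ)
open import Data.Bool.Base using (Bool; true; false; not)
open import Data.Bool.Properties using (not-¬; ¬-not; not-involutive) renaming (_≟_ to _≟ᵇ_)
open import Data.Empty using (⊥-elim)
open import Data.Nat.Base using (ℕ; zero; suc; _+_; _*_; _≤_; NonZero)
open import Data.Nat.Properties using (+-suc)
open import Data.Fin.Base using (Fin; zero; suc; toℕ; _<_)
open import Data.Fin.Subset using (Subset; _∈_; _∉_; _∪_; ⁅_⁆; ∁)
open import Data.Fin.Subset.Properties using (_∈?_; x∈∁p⇒x∉p; x∉p⇒x∈∁p)
open import Data.List.Base using (List; []; _∷_; _++_; length; tabulate)
open import Data.List.Relation.Unary.Linked using (Linked; []; [-]; _∷_)
open import Data.List.Relation.Unary.Unique.Propositional using (Unique)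
import Data.List.Membership.Propositional as List
open import Data.Maybe.Base using (Maybe; just; nothing)
open import Data.Product.Base using (∃; ∃-syntax; _×_; _,_; proj₁; proj₂)
open import Data.Sum.Base using (_⊎_)
open import Data.Vec.Base using (Vec; lookup; replicate; _[_]≔_) renaming (tabulate to tabulateᵛ)
open import Data.Vec.Properties using (lookup⇒[]=; []=⇒lookup; lookup∘tabulate)
open import Function.Base using (_∘_)
open import Function.Bundles using (_↔_; _⇔_; module Inverse; module Equivalence)
open import Relation.Binary.Core using (Rel)
open import Relation.Binary.Definitions using (Decidable; Symmetric)
open import Relation.Binary.Construct.Closure.ReflexiveTransitive using (Star; ε; _◅_)
open import Relation.Binary.Construct.Closure.Symmetric using (SymClosure; fwd; bwd)
open import Relation.Binary.PropositionalEquality using (_≡_; _≢_; refl; sym; trans; cong; subst)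
open import Relation.Nullary using (¬_; yes; no)
open import Relation.Nullary.Decidable using (recompute; ¬?)

record Graph (n : ℕ) : Set₁ where
  infix 4 _~_ _~?_
  field
    _~_      : Rel (Fin n) 0ℓ
    _~?_     : Decidable _~_
    ~-sym    : Symmetric _~_
    ~-irrefl : ∀ {v} → ¬ (v ~ v)

-- An unordered edge is listed once, with its smaller endpoint first; the
-- irrelevant fields make an edge determined by its endpoints.
record Edge {n : ℕ} (G : Graph n) : Set where
  constructor edge
  open Graph G
  field
    src tgt      : Fin n
    .ordered     : src < tgt
    .adjacent    : src ~ tgt

data Consecutive {A : Set} : List A → A → A → Set where
  here  : ∀ {x y zs} → Consecutive (x ∷ y ∷ zs) x y
  there : ∀ {x y z zs} → Consecutive zs x y → Consecutive (z ∷ zs) x y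

module _ {n : ℕ} (G : Graph n) where
  open Graph G

  Connected : Set
  Connected = ∀ u v → Star _~_ u v

  record Cycle : Set where
    field
      base     : Fin n
      rest     : List (Fin n)
      long     : 2 ≤ length rest
      distinct : Unique (base ∷ rest)
      closed   : Linked _~_ (base ∷ rest ++ base ∷ [])

    vertices : List (Fin n)
    vertices = base ∷ rest

    CycleEdge : Rel (Fin n) 0ℓ
    CycleEdge = SymClosure (Consecutive (base ∷ rest ++ base ∷ []))

  open Cycle

  -- Equality of cycles as subgraphs: independent of starting point and
  -- direction of traversal.
  SameCycle : Rel Cycle 0ℓ
  SameCycle C C′ = ∀ u v → CycleEdge C u v ⇔ CycleEdge C′ u v

  record IsTree : Set where
    field
      nonEmpty  : NonZero n
      connected : Connected
      acyclic   : ¬ Cycle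

  -- Two different cycles have at most one vertex in common.
  record IsCactus : Set where
    field
      nonEmpty  : NonZero n
      connected : Connected
      cycles    : ∀ (C C′ : Cycle) {u v} → u ≢ v →
                  u List.∈ vertices C → u List.∈ vertices C′ →
                  v List.∈ vertices C → v List.∈ vertices C′ →
                  SameCycle C C′

  Independent : Subset n → Set
  Independent A = ∀ {u v} → u ∈ A → v ∈ A → ¬ (u ~ v)

  IsBipartitionClass : Subset n → Set
  IsBipartitionClass A = Independent A × Independent (∁ A)

-- G is, up to renaming of vertices, the graph on A with adjacency R.
record Realises {n : ℕ} (G : Graph n) {A : Set} (R : Rel A 0ℓ) : Set where
  open Graph G
  field
    bijection : A ↔ Fin n
  open Inverse bijection public using (to; from)
  field
    adjacency : ∀ a b → R a b ⇔ (to a ~ to b)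

data SubdivisionVertex {m : ℕ} (T : Graph m) : Set where
  original : Fin m → SubdivisionVertex T
  midpoint : Edge T → SubdivisionVertex T

data Incidence {m : ℕ} (T : Graph m) : Rel (SubdivisionVertex T) 0ℓ where
  at-src : ∀ e → Incidence T (original (Edge.src e)) (midpoint e)
  at-tgt : ∀ e → Incidence T (original (Edge.tgt e)) (midpoint e)

SubdivisionAdj : ∀ {m} (T : Graph m) → Rel (SubdivisionVertex T) 0ℓ
SubdivisionAdj T = SymClosure (Incidence T)

record _∈𝒮 {n : ℕ} (F : Graph n) : Set₁ where
  field
    {order}     : ℕ
    T           : Graph order
    isTree      : IsTree T
    subdivision : Realises F (SubdivisionAdj T)

  -- membership in X(F) = V(T)
  data InX : Fin n → Set where
    inX : ∀ t → InX (Realises.to subdivision (original t))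

-- Every edge e of F is replaced by two paths between its ends, indexed by
-- Bool, of lengths 1 + 2 * half e s.  An edge with half e true = half e
-- false = 0 is kept.
module Replacement {n : ℕ} (F : Graph n) (half : Edge F → Bool → ℕ) where

  data Vertex : Set where
    old : Fin n → Vertex
    new : (e : Edge F) (s : Bool) → Fin (2 * half e s) → Vertex

  path : Edge F → Bool → List Vertex
  path e s = old (Edge.src e) ∷ tabulate (new e s) ++ old (Edge.tgt e) ∷ []

  data Step (u v : Vertex) : Set where
    step : ∀ e s → Consecutive (path e s) u v → Step u v

  Adj : Rel Vertex 0ℓ
  Adj = SymClosure Step

record _IsCactusOver_ {k n : ℕ} (H : Graph k) (F : Graph n) : Set where
  field
    isCactus    : IsCactus H
    half        : Edge F → Bool → ℕ
    replacement : Realises H (Replacement.Adj F half)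

  fromF : Fin n → Fin k
  fromF v = Realises.to replacement (Replacement.old v)

record _∈𝒞 {k : ℕ} (H : Graph k) : Set₁ where
  field
    {order} : ℕ
    F       : Graph order
    F∈𝒮     : F ∈𝒮
    cactus  : H IsCactusOver F

-- X is X(H), the bipartition class of H containing X(F).
record IsX {k : ℕ} {H : Graph k} (H∈𝒞 : H ∈𝒞) (X : Subset k) : Set where
  open _∈𝒞 H∈𝒞
  field
    isClass  : IsBipartitionClass H X
    contains : ∀ v → _∈𝒮.InX F∈𝒮 v → _IsCactusOver_.fromF cactus v ∈ X

data Player : Set where
  staller dominator : Player

opponent : Player → Player
opponent staller   = dominator
opponent dominator = staller

Position : ℕ → Set
Position n = Vec (Maybe Player) n

module Game {n : ℕ} (G : Graph n) (D : Subset n) where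
  open Graph G

  Unclaimed : Position n → Fin n → Set
  Unclaimed p v = lookup p v ≡ nothing

  claim : Player → Fin n → Position n → Position n
  claim a v p = p [ v ]≔ just a

  ClosedNbr : Fin n → Fin n → Set
  ClosedNbr v u = u ≡ v ⊎ v ~ u

  -- Only meaningful once every vertex is claimed.
  Won : Player → Position n → Set
  Won staller   p = ∃[ v ] (v ∉ D × (∀ u → ClosedNbr v u → lookup p u ≡ just staller))
  Won dominator p = ¬ Won staller p

  -- Wins a t p: player a has a winning strategy from position p with player
  -- t to move.
  data Wins (a : Player) : Player → Position n → Set where
    over   : ∀ {t p} → (∀ v → ¬ Unclaimed p v) → Won a p → Wins a t p
    mine   : ∀ {p} v → Unclaimed p v →
             Wins a (opponent a) (claim a v p) → Wins a a p
    theirs : ∀ {p} → ∃ (Unclaimed p) →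
             (∀ v → Unclaimed p v → Wins a a (claim (opponent a) v p)) →
             Wins a (opponent a) p

  HasWinningStrategy : Player → Set
  HasWinningStrategy a = Wins a staller (replicate n nothing)

StallerWins DominatorWins : ∀ {n} → Graph n → Subset n → Set
StallerWins   G D = Game.HasWinningStrategy G D staller
DominatorWins G D = Game.HasWinningStrategy G D dominator

record IsMBDCritical {n : ℕ} (G : Graph n) (D : Subset n) : Set where
  field
    stallerWins   : StallerWins G D
    dominatorWins : ∀ v → v ∉ D → DominatorWins G (D ∪ ⁅ v ⁆)

record IsAtomicMBDCritical {n : ℕ} (G : Graph n) (D : Subset n) : Set where
  open Graph G
  field
    critical    : IsMBDCritical G D
    independent : Independent G D
    nonIsolated : ∀ v → v ∈ D → ∃[ u ] v ~ u

-- X(H) is well defined: it exists and is unique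

private
  parity : ℕ → Bool → Bool
  parity zero    b = b
  parity (suc i) b = parity i (not b)

  parity-odd : ∀ h b → parity (suc (2 * h)) b ≡ not b
  parity-odd zero    b = refl
  parity-odd (suc h) b rewrite +-suc h (h + 0) | not-involutive b = parity-odd h b

  alternating : ∀ {A : Set} (c : A → Bool) k (f : Fin k → A) x y →
                (∀ i → c (f i) ≡ parity (suc (toℕ i)) (c x)) →
                c y ≡ parity (suc k) (c x) →
                Linked (λ a b → c b ≡ not (c a)) (x ∷ tabulate f ++ y ∷ [])
  alternating c zero    f x y _  cy = cy ∷ [-]
  alternating c (suc k) f x y cf cy =
    cf zero ∷ alternating c k (f ∘ suc) (f zero) y
      (λ i → trans (cf (suc i)) (cong (parity (suc (toℕ i))) (sym (cf zero))))
      (trans cy (cong (parity (suc k)) (sym (cf zero))))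

  linked⇒consecutive : ∀ {A : Set} {R : Rel A 0ℓ} {xs x y} →
                       Linked R xs → Consecutive xs x y → R x y
  linked⇒consecutive (r ∷ _)  here      = r
  linked⇒consecutive (_ ∷ rs) (there c) = linked⇒consecutive rs c
  linked⇒consecutive [-]      (there ())

  realised-colouring : ∀ {n} {G : Graph n} {A : Set} {R : Rel A 0ℓ} (r : Realises G R)
                       (c : A → Bool) → (∀ {a b} → R a b → c b ≢ c a) →
                       ∀ {u v} → Graph._~_ G u v →
                       c (Realises.from r v) ≢ c (Realises.from r u)
  realised-colouring {G = G} r c proper {u} {v} uv =
    proper (Equivalence.from (adjacency (from u) (from v)) uv′)
    where
    open Realises r
    open Graph G
    back : ∀ w → w ≡ to (from w)
    back w = sym (Inverse.inverseˡ bijection refl)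
    uv′ : to (from u) ~ to (from v)
    uv′ = subst (_~ to (from v)) (back u) (subst (u ~_) (back v) uv)

  module _ {k : ℕ} {H : Graph k} (H∈𝒞 : H ∈𝒞) where
    open _∈𝒞 H∈𝒞
    open _∈𝒮 F∈𝒮 using (T; subdivision; inX)
    open _IsCactusOver_ cactus
    open Replacement F half

    colourT : SubdivisionVertex T → Bool
    colourT (original _) = true
    colourT (midpoint _) = false

    colourT-proper : ∀ {a b} → SubdivisionAdj T a b → colourT b ≢ colourT a
    colourT-proper (fwd (at-src _)) ()
    colourT-proper (fwd (at-tgt _)) ()
    colourT-proper (bwd (at-src _)) ()
    colourT-proper (bwd (at-tgt _)) ()

    colourF : Fin order → Bool
    colourF = colourT ∘ Realises.from subdivision

    colourF-edge : (e : Edge F) → colourF (Edge.tgt e) ≡ not (colourF (Edge.src e))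
    colourF-edge (edge s t _ st) =
      ¬-not (recompute (¬? (colourF t ≟ᵇ colourF s))
              (realised-colouring subdivision colourT colourT-proper st))

    colourH : Vertex → Bool
    colourH (old v)     = colourF v
    colourH (new e _ i) = parity (suc (toℕ i)) (colourF (Edge.src e))

    step-proper : ∀ {a b} → Step a b → colourH b ≡ not (colourH a)
    step-proper (step e s c) = linked⇒consecutive
      (alternating colourH (2 * half e s) (new e s) _ _ (λ _ → refl)
        (trans (colourF-edge e) (sym (parity-odd (half e s) _)))) c

    colourH-proper : ∀ {a b} → Adj a b → colourH b ≢ colourH a
    colourH-proper (fwd s) eq = not-¬ eq (step-proper s)
    colourH-proper (bwd s) eq = not-¬ (sym eq) (step-proper s)

    colour : Fin k → Bool
    colour = colourH ∘ Realises.from replacement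

    colour-proper : ∀ {u v} → Graph._~_ H u v → colour v ≢ colour u
    colour-proper = realised-colouring replacement colourH colourH-proper

    X : Subset k
    X = tabulateᵛ colour

    ∈X⁺ : ∀ {v} → colour v ≡ true → v ∈ X
    ∈X⁺ {v} eq = lookup⇒[]= v X (trans (lookup∘tabulate colour v) eq)

    ∈X⁻ : ∀ {v} → v ∈ X → colour v ≡ true
    ∈X⁻ {v} v∈X = trans (sym (lookup∘tabulate colour v)) ([]=⇒lookup v∈X)

    ∉X⁻ : ∀ {v} → v ∈ ∁ X → colour v ≡ false
    ∉X⁻ v∈∁X = ¬-not (x∈∁p⇒x∉p v∈∁X ∘ ∈X⁺)

    X-isX : IsX H∈𝒞 X
    X-isX = record
      { isClass  = (λ u∈ v∈ uv → colour-proper uv (trans (∈X⁻ v∈) (sym (∈X⁻ u∈))))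
                 , (λ u∈ v∈ uv → colour-proper uv (trans (∉X⁻ v∈) (sym (∉X⁻ u∈))))
      ; contains = λ { _ (inX t) → ∈X⁺ (trans
          (cong colourH (Inverse.inverseʳ (Realises.bijection replacement) refl))
          (cong colourT (Inverse.inverseʳ (Realises.bijection subdivision) refl))) }
      }

X-exists : ∀ {k} {H : Graph k} (H∈𝒞 : H ∈𝒞) → ∃ (IsX H∈𝒞)
X-exists H∈𝒞 = X H∈𝒞 , X-isX H∈𝒞

X-unique : ∀ {k} {H : Graph k} (H∈𝒞 : H ∈𝒞) {X Y : Subset k} →
           IsX H∈𝒞 X → IsX H∈𝒞 Y → ∀ {v} → v ∈ X → v ∈ Y
X-unique {H = H} H∈𝒞 {X} {Y} isX isY {v} =
  proj₁ (spread (IsCactus.connected isCactus root v)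
    ((λ _ → IsX.contains isY _ x₀) , (λ _ → IsX.contains isX _ x₀)))
  where
  open Graph H
  open _∈𝒞 H∈𝒞
  open _∈𝒮 F∈𝒮 using (T; isTree; inX; InX; subdivision)
  open _IsCactusOver_ cactus

  element : ∀ {m} → NonZero m → Fin m
  element {suc _} _ = zero

  x₀ : InX (Realises.to subdivision (original (element (IsTree.nonEmpty isTree))))
  x₀ = inX _

  root = fromF (Realises.to subdivision (original (element (IsTree.nonEmpty isTree))))

  Agree : Fin _ → Set
  Agree u = (u ∈ X → u ∈ Y) × (u ∈ Y → u ∈ X)

  across : ∀ {A B u w} → IsBipartitionClass H A → IsBipartitionClass H B → u ~ w →
           (u ∈ B → u ∈ A) → w ∈ A → w ∈ B
  across {A} {B} {u} {w} (indA , _) (_ , ind∁B) uw B⇒A w∈A with w ∈? B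
  ... | yes w∈B = w∈B
  ... | no  w∉B = ⊥-elim (ind∁B
        (x∉p⇒x∈∁p (λ u∈B → indA (B⇒A u∈B) w∈A uw)) (x∉p⇒x∈∁p w∉B) uw)

  spread : ∀ {u w} → Star _~_ u w → Agree u → Agree w
  spread ε          agree   = agree
  spread (uw ◅ ws) (f , g) = spread ws
    ( across (IsX.isClass isX) (IsX.isClass isY) uw g
    , across (IsX.isClass isY) (IsX.isClass isX) uw f )

{-# OPTIONS --safe #-}
module Submission where

-- Call a set of vertices decomposable if it is a single vertex of X, or if it
-- arises from two decomposable sets without edges between them by adding one
-- vertex y ∉ X that is adjacent to both.  On a decomposable graph Staller wins
-- by claiming y: Dominator's answer spoils at most one part, and she goes on in
-- the other, until a vertex of X with all its neighbours claimed is left.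
-- Moreover, for each v in X the graph minus v has a perfect matching (match y
-- into the part avoiding v), so once v is predominated Dominator wins by pairing.
--
-- An F-cactus is decomposable: deleting all midpoints of the subdivided tree T
-- leaves, at every vertex t of T, a spider with legs of even length (the rests of
-- the two odd paths replacing an edge at t), spiders are decomposed leg by leg,
-- and the midpoints join the spiders along T.

open import Defs
open import Data.Bool.Base using (Bool; true; false)
open import Data.Bool.Properties using () renaming (_≟_ to _≟ᵇ_)
open import Data.Fin.Base using (Fin; zero; suc; _<_)
open import Data.Fin.Properties using (_≟_; _<?_; any?; <-irrefl; <-cmp; <-asym)
open import Data.Fin.Subset using (Subset; ∁; ⁅_⁆) renaming (_∈_ to _∈ˢ_; _∉_ to _∉ˢ_; _∪_ to _∪ˢ_)
open import Data.Fin.Subset.Properties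
  using (_∈?_; x∈p⇒x∉∁p; x∉∁p⇒x∈p; x∉p⇒x∈∁p; x∈∁p⇒x∉p; x∈⁅x⁆; q⊆p∪q)
open import Data.List.Base
  using (List; []; _∷_; _++_; concatMap; length; map; reverse; tabulate; allFin; cartesianProduct;
         filter; deduplicate)
open import Data.List.Membership.DecPropositional using () renaming (_∈?_ to member?)
open import Data.List.Membership.Propositional using (_∈_; _∉_; lose)
open import Data.List.Membership.Propositional.Properties
  using (∈-++⁺ʳ; ∈-++⁺ˡ; ∈-++⁻; ∈-allFin; ∈-cartesianProduct⁺; ∈-concatMap⁺; ∈-deduplicate⁺;
         ∈-filter⁺; ∈-filter⁻; ∈-insert; ∈-map⁺; ∈-map⁻; ∈-tabulate⁺; ∈-tabulate⁻)
open import Data.List.Properties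
  using (concatMap-++; map-++; unfold-reverse; reverse-++; length-reverse; length-tabulate;
         reverse-involutive; map-id)
open import Data.List.Relation.Binary.Disjoint.Propositional using (Disjoint)
open import Data.List.Relation.Binary.Permutation.Propositional
  using (_↭_; ↭⇒↭ₛ; ↭-refl; ↭-sym; prep; module PermutationReasoning)
open import Data.List.Relation.Binary.Permutation.Propositional.Properties
  using (shift; ∈-resp-↭; ↭-reverse)
  renaming (++⁺ to ↭-++⁺)
open import Data.List.Relation.Binary.Permutation.Setoid.Properties using (Unique-resp-↭)
open import Data.List.Relation.Unary.All
  using (All; []; _∷_)
  renaming (map to mapAll; lookup to lookupAll; tabulate to tabulateAll)
open import Data.List.Relation.Unary.All.Properties using () renaming (++⁺ to All-++⁺)
open import Data.List.Relation.Unary.AllPairs using ([]; _∷_)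
open import Data.List.Relation.Unary.Any using (here; there)
open import Data.List.Relation.Unary.Linked using (Linked; [-]; _∷_)
open import Data.List.Relation.Unary.Unique.DecPropositional.Properties using (deduplicate-!)
open import Data.List.Relation.Unary.Unique.Propositional using (Unique)
open import Data.List.Relation.Unary.Unique.Propositional.Properties
  using (Unique[x∷xs]⇒x∉xs)
  renaming (++⁺ to Unique-++⁺; map⁺ to Unique-map⁺; tabulate⁺ to Unique-tabulate⁺;
            filter⁺ to Unique-filter⁺)
open import Data.Maybe.Base using (just; nothing)
open import Data.Nat.Base using (ℕ; zero; suc; _+_; _*_; _≤_; z≤n; s≤s; NonZero)
open import Data.Nat.Properties using (suc-injective; +-suc)
open import Data.Product.Base using (∃-syntax; ∃; _×_; _,_; proj₁; proj₂; uncurry)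
open import Data.Product.Properties using () renaming (≡-dec to ×-≡-dec)
open import Data.Sum.Base using (_⊎_; inj₁; inj₂; [_,_]′)
open import Data.Vec.Base using ([]; _∷_; lookup; _[_]≔_)
open import Data.Vec.Properties using (lookup∘update; lookup∘update′; lookup-replicate)
open import Function.Base using (_∘_; id; case_of_)
open import Function.Bundles using (module Inverse; module Equivalence)
open import Level using (0ℓ)
open import Relation.Binary.Construct.Closure.ReflexiveTransitive using (Star; ε; _◅_)
open import Relation.Binary.Construct.Closure.Symmetric using (SymClosure; fwd; bwd; symmetric)
open import Relation.Binary.Core using (Rel)
open import Relation.Binary.Definitions using (tri<; tri≈; tri>; Symmetric; DecidableEquality)
open import Relation.Binary.PropositionalEquality
  using (_≡_; _≢_; refl; sym; trans; cong; subst; ≢-sym; subst₂)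
open import Relation.Binary.PropositionalEquality.Properties using (setoid)
open import Relation.Nullary using (¬_; Dec; yes; no)
open import Relation.Nullary.Decidable using (recompute)
open import Relation.Nullary.Negation using (contradiction)

private variable
  A : Set
  x y z u v : A
  xs ys zs ws : List A

-- Membership and distinctness in concatenated lists.

∈-++-∷⁻ : ∀ xs → v ∈ xs ++ y ∷ ys → v ∈ xs ⊎ v ≡ y ⊎ v ∈ ys
∈-++-∷⁻ xs v∈ with ∈-++⁻ xs v∈
... | inj₁ p         = inj₁ p
... | inj₂ (here p)  = inj₂ (inj₁ p)
... | inj₂ (there p) = inj₂ (inj₂ p)

Unique-++⁻ : ∀ xs → Unique (xs ++ ys) → Unique xs × Unique ys × Disjoint xs ys
Unique-++⁻ []       u           = [] , u , λ ()
Unique-++⁻ (x ∷ xs) (x≢ ∷ u) with uxs , uys , dis ← Unique-++⁻ xs u =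
  tabulateAll (λ y∈ → lookupAll x≢ (∈-++⁺ˡ y∈)) ∷ uxs , uys ,
  λ { (here refl , v∈ys) → lookupAll x≢ (∈-++⁺ʳ xs v∈ys) refl
    ; (there v∈xs , v∈ys) → dis (v∈xs , v∈ys) }

Unique-++-∷⁻ : ∀ xs → Unique (xs ++ y ∷ ys) →
               Unique xs × Unique ys × y ∉ xs × y ∉ ys × Disjoint xs ys
Unique-++-∷⁻ xs u with uxs , uyys@(_ ∷ uys) , dis ← Unique-++⁻ xs u =
  uxs , uys , (λ y∈ → dis (y∈ , here refl)) , Unique[x∷xs]⇒x∉xs uyys ,
  λ (p , q) → dis (p , there q)

-- Decomposable sets and their near-perfect matchings.

module _ {V : Set} (_~_ : Rel V 0ℓ) (InX : V → Set) where

  -- The list is the in-order traversal of a binary tree with leaves in X and inner nodes `y`.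
  -- Distinctness of its entries is kept apart, as a separate `Unique` hypothesis.
  data Decomposable : List V → Set where
    single : InX x → Decomposable (x ∷ [])
    join   : ∀ {y a b xs ys} → ¬ InX y → a ∈ xs → y ~ a → b ∈ ys → y ~ b →
             (∀ {u v} → u ∈ xs → v ∈ ys → ¬ (u ~ v)) →
             Decomposable xs → Decomposable ys → Decomposable (xs ++ y ∷ ys)

module _ {V W : Set} {_~_ : Rel V 0ℓ} {InX : V → Set} {_~′_ : Rel W 0ℓ} {InX′ : W → Set} (f : V → W)
         (f-~ : ∀ {u v} → u ~ v → f u ~′ f v) (f-~⁻ : ∀ {u v} → f u ~′ f v → u ~ v)
         (f-X : ∀ {u} → InX u → InX′ (f u)) (f-X⁻ : ∀ {u} → InX′ (f u) → InX u) where

  Decomposable-map : Decomposable _~_ InX xs → Decomposable _~′_ InX′ (map f xs)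
  Decomposable-map (single x∈X) = single (f-X x∈X)
  Decomposable-map (join {y = y} {xs = xs} {ys = ys} y∉X a∈ ya b∈ yb sep l r) =
    subst (Decomposable _~′_ InX′) (sym (map-++ f xs (y ∷ ys)))
      (join (y∉X ∘ f-X⁻) (∈-map⁺ f a∈) (f-~ ya) (∈-map⁺ f b∈) (f-~ yb) sep′
        (Decomposable-map l) (Decomposable-map r))
    where
    sep′ : ∀ {u v} → u ∈ map f xs → v ∈ map f ys → ¬ (u ~′ v)
    sep′ u∈ v∈ uv with ∈-map⁻ f u∈ | ∈-map⁻ f v∈
    ... | _ , u∈xs , refl | _ , v∈ys , refl = sep u∈xs v∈ys (f-~⁻ uv)

bothEnds : A × A → List A
bothEnds (x , y) = x ∷ y ∷ []

flatten : List (A × A) → List A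
flatten = concatMap bothEnds

-- When `xs` has no repetitions, the single permutation `covers` says at once that the pairs are
-- disjoint, avoid `v` and exhaust everything else.
record NearMatching (_~_ : Rel A 0ℓ) (xs : List A) (v : A) : Set where
  field
    pairs    : List (A × A)
    covers   : xs ↭ v ∷ flatten pairs
    adjacent : All (uncurry _~_) pairs

module _ {V : Set} {_~_ : Rel V 0ℓ} {InX : V → Set}
         (alternates : ∀ {u v} → u ~ v → ¬ InX u → InX v) where

  open NearMatching

  -- The partner of `y` is `a` or `b`, whichever lies in the part without `v`. It belongs to X
  -- because `y` does not, so induction matches that part up to this partner and the other part up
  -- to `v`.
  nearMatching : Decomposable _~_ InX xs → v ∈ xs → InX v → NearMatching _~_ xs v
  nearMatching (single _) (here refl) _ =
    record { pairs = [] ; covers = ↭-refl ; adjacent = [] }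
  nearMatching {v = v} (join {y} {a} {b} {xs} {ys} y∉X a∈ ya b∈ yb _ l r) v∈ v∈X
    with ∈-++-∷⁻ xs v∈
  ... | inj₂ (inj₁ refl) = contradiction v∈X y∉X
  ... | inj₁ v∈xs = record
    { pairs    = pairs L ++ (y , b) ∷ pairs R
    ; covers   = subst (λ ws → xs ++ y ∷ ys ↭ v ∷ ws)
                   (sym (concatMap-++ bothEnds (pairs L) _))
                   (↭-++⁺ (covers L) (prep y (covers R)))
    ; adjacent = All-++⁺ (adjacent L) (yb ∷ adjacent R)
    }
    where
    L = nearMatching l v∈xs v∈X
    R = nearMatching r b∈ (alternates yb y∉X)
  ... | inj₂ (inj₂ v∈ys) = record
    { pairs    = (y , a) ∷ pairs L ++ pairs R
    ; covers   = covers′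
    ; adjacent = ya ∷ All-++⁺ (adjacent L) (adjacent R)
    }
    where
    L = nearMatching l a∈ (alternates ya y∉X)
    R = nearMatching r v∈ys v∈X
    open PermutationReasoning
    covers′ : xs ++ y ∷ ys ↭ v ∷ y ∷ a ∷ flatten (pairs L ++ pairs R)
    covers′ rewrite concatMap-++ bothEnds (pairs L) (pairs R) = begin
      xs ++ y ∷ ys                                      ↭⟨ shift y xs ys ⟩
      y ∷ xs ++ ys                                      ↭⟨ prep y (↭-++⁺ (covers L) (covers R)) ⟩
      y ∷ a ∷ flatten (pairs L) ++ v ∷ flatten (pairs R) ↭⟨ shift v (y ∷ a ∷ flatten (pairs L)) _ ⟩
      v ∷ y ∷ a ∷ flatten (pairs L) ++ flatten (pairs R) ∎

-- Positions and the number of unclaimed vertices.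

free : ∀ {n} → Position n → ℕ
free []             = 0
free (nothing ∷ p)  = suc (free p)
free (just _ ∷ p)   = free p

free-claim : ∀ {n} (p : Position n) v {a} → lookup p v ≡ nothing →
             free p ≡ suc (free (p [ v ]≔ just a))
free-claim (nothing ∷ p) zero    _   = refl
free-claim (nothing ∷ p) (suc v) v-u = cong suc (free-claim p v v-u)
free-claim (just _ ∷ p)  (suc v) v-u = free-claim p v v-u

free-claim-≡ : ∀ {n} (p : Position n) {v a f} → lookup p v ≡ nothing →
               free p ≡ suc f → free (p [ v ]≔ just a) ≡ f
free-claim-≡ p {v} v-u eq = suc-injective (trans (sym (free-claim p v v-u)) eq)

unclaimed? : ∀ {n} (p : Position n) v → Dec (lookup p v ≡ nothing)
unclaimed? p v with lookup p v
... | nothing = yes refl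
... | just _  = no λ ()

no-free : ∀ {n} (p : Position n) → free p ≡ 0 → ∀ v → lookup p v ≢ nothing
no-free p eq v v-u with () ← trans (sym eq) (free-claim p v {staller} v-u)

claimed≢unclaimed : ∀ {n} (p : Position n) {u w a} →
                    lookup p u ≡ just a → lookup p w ≡ nothing → u ≢ w
claimed≢unclaimed p u-c w-u refl with () ← trans (sym u-c) w-u

lookup-claim-other : ∀ {n} (p : Position n) {u w a s} → u ≢ w →
                     lookup p u ≡ s → lookup (p [ w ]≔ just a) u ≡ s
lookup-claim-other p u≢w eq = trans (lookup∘update′ u≢w p _) eq

lookup-claim-claimed : ∀ {n} (p : Position n) {u w a b} → lookup p w ≡ nothing →
                       lookup p u ≡ just b → lookup (p [ w ]≔ just a) u ≡ just b
lookup-claim-claimed p w-u u-c = lookup-claim-other p (claimed≢unclaimed p u-c w-u) u-c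

-- Staller's strategy on a decomposable set.

module _ {n : ℕ} (G : Graph n) (D : Subset n) where
  open Graph G
  open Game G D

  private
    -- Claims are never revoked, so a completed closed neighbourhood stays complete. As `Wins` is
    -- only decided on a full board, the remaining moves are played out arbitrarily, by recursion on
    -- the number `f` of unclaimed vertices.
    persists : ∀ f t p → free p ≡ f → Won staller p → Wins staller t p
    persists f t p eq won with any? (unclaimed? p)
    persists f       t p eq won | no none = over (λ v v-u → none (v , v-u)) won
    persists zero    t p eq won | yes (v , v-u) = contradiction v-u (no-free p eq v)
    persists (suc f) t p eq won@(c , c∉D , N) | yes (v , v-u) = move t
      where
      won′ : ∀ {a w} → Unclaimed p w → Won staller (claim a w p)
      won′ w-u = c , c∉D , λ u cu → lookup-claim-claimed p w-u (N u cu)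
      next : ∀ {a} t w → Unclaimed p w → Wins staller t (claim a w p)
      next t w w-u = persists f t _ (free-claim-≡ p w-u eq) (won′ w-u)
      move : ∀ t → Wins staller t p
      move staller   = mine v v-u (next dominator v v-u)
      move dominator = theirs (v , v-u) (next staller)

  won⇒wins : ∀ {t p} → Won staller p → Wins staller t p
  won⇒wins = persists _ _ _ refl

  -- Provides the unclaimed vertex that `theirs` asks for after Staller has taken `y`.
  decomposable⇒inhabited : ∀ {InX} → Decomposable _~_ InX xs → ∃ (_∈ xs)
  decomposable⇒inhabited (single _)             = _ , here refl
  decomposable⇒inhabited (join {xs = xs} _ _ _ _ _ _ _ _) = _ , ∈-insert xs

  -- The invariant is that `xs` is untouched and that Staller owns every neighbour outside `xs` of
  -- an undominated vertex in `xs`. Claiming `y` makes the invariant hold for both parts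
  -- simultaneously, and one reply destroys it in at most one of them. For a single vertex it says
  -- that only this vertex is missing from its closed neighbourhood.
  stallerStrategy : Decomposable _~_ (_∉ˢ D) xs → Unique xs → ∀ {p} →
    (∀ {v} → v ∈ xs → Unclaimed p v) →
    (∀ {v u} → v ∈ xs → v ∉ˢ D → v ~ u → u ∉ xs → lookup p u ≡ just staller) →
    Wins staller staller p
  stallerStrategy (single {x} x∉D) _ {p} unclaimed outside =
    mine x (unclaimed (here refl)) (won⇒wins (x , x∉D , nbr))
    where
    nbr : ∀ u → ClosedNbr x u → lookup (claim staller x p) u ≡ just staller
    nbr u (inj₁ refl) = lookup∘update x p _
    nbr u (inj₂ xu)   = lookup-claim-claimed p (unclaimed (here refl))
      (outside (here refl) x∉D xu λ { (here refl) → ~-irrefl xu })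
  stallerStrategy (join {y} {xs = xs} {ys = ys} y∉X _ _ _ _ sep l r) unq {p} unclaimed outside
    with uxs , uys , y∉xs , y∉ys , dis ← Unique-++-∷⁻ xs unq =
    mine y y-u (theirs (_ , after (∈-++⁺ˡ (proj₂ some)) λ { refl → y∉xs (proj₂ some) }) reply)
    where
    y-u : Unclaimed p y
    y-u = unclaimed (∈-insert xs)
    some = decomposable⇒inhabited l
    p′ = claim staller y p
    after : ∀ {v} → v ∈ xs ++ y ∷ ys → v ≢ y → Unclaimed p′ v
    after v∈ v≢y = lookup-claim-other p v≢y (unclaimed v∈)
    outside′ : ∀ {v u} → v ∈ xs ++ y ∷ ys → v ∉ˢ D → v ~ u → u ∉ xs → u ∉ ys →
               lookup p′ u ≡ just staller
    outside′ {u = u} v∈ v∉D vu u∉xs u∉ys with u ≟ y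
    ... | yes refl = lookup∘update y p _
    ... | no u≢y   = lookup-claim-claimed p y-u (outside v∈ v∉D vu λ u∈ →
            [ u∉xs , [ u≢y , u∉ys ]′ ]′ (∈-++-∷⁻ xs u∈))
    reply : ∀ w → Unclaimed p′ w → Wins staller staller (claim dominator w p′)
    reply w w-u with member? _≟_ w xs
    -- This covers a reply in `ys` as well as one outside the whole set; either way the left part is
    -- intact. By `sep`, an outside neighbour of the left part is not in `ys`.
    ... | no w∉xs = stallerStrategy l uxs
            (λ v∈ → lookup-claim-other p′ (λ { refl → w∉xs v∈ })
                      (after (∈-++⁺ˡ v∈) λ { refl → y∉xs v∈ }))
            (λ v∈ v∉D vu u∉xs → lookup-claim-claimed p′ w-u
                      (outside′ (∈-++⁺ˡ v∈) v∉D vu u∉xs (λ u∈ys → sep v∈ u∈ys vu)))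
    ... | yes w∈xs = stallerStrategy r uys
            (λ v∈ → lookup-claim-other p′ (λ { refl → dis (w∈xs , v∈) })
                      (after (∈-++⁺ʳ xs (there v∈)) λ { refl → y∉ys v∈ }))
            (λ v∈ v∉D vu u∉ys → lookup-claim-claimed p′ w-u
                      (outside′ (∈-++⁺ʳ xs (there v∈)) v∉D vu
                        (λ u∈xs → sep u∈xs v∈ (~-sym vu)) u∉ys))

  -- Dominator's pairing strategy.

  data Secured (p : Position n) : Fin n × Fin n → Set where
    untouched  : ∀ {x y} → Unclaimed p x → Unclaimed p y → Secured p (x , y)
    by-first   : ∀ {x y} → lookup p x ≡ just dominator → Secured p (x , y)
    by-second  : ∀ {x y} → lookup p y ≡ just dominator → Secured p (x , y)

  secured-staller : ∀ {p w e} → Unclaimed p w → w ∉ bothEnds e → Secured p e →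
                    Secured (claim staller w p) e
  secured-staller {p} w-u w∉ (untouched x-u y-u) = untouched
    (lookup-claim-other p (λ { refl → w∉ (here refl) }) x-u)
    (lookup-claim-other p (λ { refl → w∉ (there (here refl)) }) y-u)
  secured-staller {p} w-u w∉ (by-first x-d) = by-first (lookup-claim-claimed p w-u x-d)
  secured-staller {p} w-u w∉ (by-second y-d) = by-second (lookup-claim-claimed p w-u y-d)

  secured-dominator : ∀ {p w} → Unclaimed p w → ∀ {e} → Secured p e →
                      Secured (claim dominator w p) e
  secured-dominator {p} {w} w-u (by-first x-d) = by-first (lookup-claim-claimed p w-u x-d)
  secured-dominator {p} {w} w-u (by-second y-d) = by-second (lookup-claim-claimed p w-u y-d)
  secured-dominator {p} {w} w-u {x , y} (untouched x-u y-u) with x ≟ w | y ≟ w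
  ... | yes refl | _        = by-first (lookup∘update x p _)
  ... | no _     | yes refl = by-second (lookup∘update y p _)
  ... | no x≢w   | no y≢w   = untouched (lookup-claim-other p x≢w x-u) (lookup-claim-other p y≢w y-u)

  secured-all-staller : ∀ {p w} → Unclaimed p w → ∀ {es} → w ∉ flatten es → All (Secured p) es →
                        All (Secured (claim staller w p)) es
  secured-all-staller w-u w∉ []       = []
  secured-all-staller w-u w∉ (s ∷ ss) =
    secured-staller w-u (w∉ ∘ ∈-++⁺ˡ) s ∷ secured-all-staller w-u (w∉ ∘ ∈-++⁺ʳ _) ss

  -- The invariant, every pair secured, is required only when Staller is to move. After her move it
  -- either still holds or is restored by a claim of Dominator at `z`.
  Answer : Position n → List (Fin n × Fin n) → Set
  Answer p es = All (Secured p) es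
              ⊎ ∃[ z ] (Unclaimed p z × All (Secured (claim dominator z p)) es)

  -- As `flatten es` has no repetitions, `w` lies in at most one pair. If that pair was untouched,
  -- its other end is the reply; all other pairs remain secured.
  answer : ∀ {p} es → Unique (flatten es) → All (Secured p) es →
           ∀ {w} → Unclaimed p w → Answer (claim staller w p) es
  answer []             _   []       _ = inj₁ []
  answer {p} ((x , y) ∷ es) ((x≢y ∷ x≢es) ∷ (y≢es ∷ unq)) (s ∷ ss) {w} w-u with x ≟ w | y ≟ w
  ... | yes refl | _ = first s
    where
    x∉es = λ x∈ → lookupAll x≢es x∈ refl
    rest = secured-all-staller w-u x∉es ss
    first : Secured p (x , y) → Answer (claim staller x p) ((x , y) ∷ es)
    first (untouched _ y-u) = inj₂ (y , y-u′ , by-second (lookup∘update y (claim staller x p) _)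
                                            ∷ mapAll (secured-dominator y-u′) rest)
      where y-u′ = lookup-claim-other p (≢-sym x≢y) y-u
    first (by-first x-d) = contradiction refl (claimed≢unclaimed p x-d w-u)
    first (by-second y-d) = inj₁ (by-second (lookup-claim-claimed p w-u y-d) ∷ rest)
  ... | no _ | yes refl = second s
    where
    y∉es = λ y∈ → lookupAll y≢es y∈ refl
    rest = secured-all-staller w-u y∉es ss
    second : Secured p (x , y) → Answer (claim staller y p) ((x , y) ∷ es)
    second (untouched x-u _) = inj₂ (x , x-u′ , by-first (lookup∘update x (claim staller y p) _)
                                             ∷ mapAll (secured-dominator x-u′) rest)
      where x-u′ = lookup-claim-other p x≢y x-u
    second (by-first x-d) = inj₁ (by-first (lookup-claim-claimed p w-u x-d) ∷ rest)
    second (by-second y-d) = contradiction refl (claimed≢unclaimed p y-d w-u)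
  ... | no x≢w | no y≢w = [ (λ all → inj₁ (s′ ∷ all))
                          , (λ (z , z-u , all) → inj₂ (z , z-u , secured-dominator z-u s′ ∷ all))
                          ]′ (answer es unq ss w-u)
    where
    s′ = secured-staller w-u (λ { (here refl) → x≢w refl ; (there (here refl)) → y≢w refl }) s

  secured⇒not-both-staller : ∀ {p x y} → Secured p (x , y) →
                             lookup p x ≡ just staller → lookup p y ≢ just staller
  secured⇒not-both-staller {p} (untouched x-u _) x-s y-s = claimed≢unclaimed p x-s x-u refl
  secured⇒not-both-staller (by-first x-d)  x-s y-s with () ← trans (sym x-d) x-s
  secured⇒not-both-staller (by-second y-d) x-s y-s with () ← trans (sym y-d) y-s

  -- The partner of `v` is a neighbour of `v`, so the closed neighbourhood of `v` contains a whole
  -- pair, and Staller never owns both ends of a secured pair.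
  secured⇒dominated : ∀ {p es} → All (uncurry _~_) es → All (Secured p) es → v ∈ flatten es →
                      ¬ (∀ u → ClosedNbr v u → lookup p u ≡ just staller)
  secured⇒dominated (_ ∷ adj) (_ ∷ ss) (there (there v∈)) N = secured⇒dominated adj ss v∈ N
  secured⇒dominated (xy ∷ _) (s ∷ _) (here refl) N =
    secured⇒not-both-staller s (N _ (inj₁ refl)) (N _ (inj₂ xy))
  secured⇒dominated (xy ∷ _) (s ∷ _) (there (here refl)) N =
    secured⇒not-both-staller s (N _ (inj₂ (~-sym xy))) (N _ (inj₁ refl))

  module PairingStrategy (es : List (Fin n × Fin n)) (unq : Unique (flatten es))
         (adj : All (uncurry _~_) es) (covers : ∀ {v} → v ∉ˢ D → v ∈ flatten es) where

    won : ∀ {p} → All (Secured p) es → Won dominator p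
    won ss (v , v∉D , N) = secured⇒dominated adj ss (covers v∉D) N

    private
      play : ∀ f p → free p ≡ f → All (Secured p) es → Wins dominator staller p
      respond : ∀ f p → free p ≡ f → Answer p es → Wins dominator dominator p

      play f p eq ss with any? (unclaimed? p)
      play f       p eq ss | no none = over (λ v v-u → none (v , v-u)) (won ss)
      play zero    p eq ss | yes (v , v-u) = contradiction v-u (no-free p eq v)
      play (suc f) p eq ss | yes v = theirs v λ w w-u →
        respond f _ (free-claim-≡ p w-u eq) (answer es unq ss w-u)

      respond zero p eq (inj₁ ss) = over (no-free p eq) (won ss)
      respond zero p eq (inj₂ (z , z-u , _)) = contradiction z-u (no-free p eq z)
      respond (suc f) p eq (inj₂ (z , z-u , ss)) = mine z z-u (play f _ (free-claim-≡ p z-u eq) ss)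
      respond (suc f) p eq (inj₁ ss) with any? (unclaimed? p)
      ... | no none = over (λ v v-u → none (v , v-u)) (won ss)
      ... | yes (z , z-u) = mine z z-u
        (play f _ (free-claim-≡ p z-u eq) (mapAll (secured-dominator z-u) ss))

    dominatorWins : DominatorWins G D
    dominatorWins = play _ _ refl (tabulateAll λ {(x , y)} _ →
      untouched (lookup-replicate x nothing) (lookup-replicate y nothing))

-- From decomposability to atomic criticality.

module _ {k : ℕ} (H : Graph k) (X : Subset k) (isClass : IsBipartitionClass H X) where
  open Graph H

  alternates : ∀ {u v} → u ~ v → u ∉ˢ X → v ∈ˢ X
  alternates {u} {v} uv u∉X with v ∈? X
  ... | yes v∈X = v∈X
  ... | no v∉X  = contradiction uv (proj₂ isClass (x∉p⇒x∈∁p u∉X) (x∉p⇒x∈∁p v∉X))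

  -- A vertex outside X can enter only as the `y` of some join, and there it is adjacent to `a`.
  decomposable⇒nonIsolated : Decomposable _~_ (_∈ˢ X) xs → v ∈ xs → v ∉ˢ X → ∃[ u ] v ~ u
  decomposable⇒nonIsolated (single x∈X) (here refl) v∉X = contradiction x∈X v∉X
  decomposable⇒nonIsolated (join {xs = xs} _ _ ya _ _ _ l r) v∈ v∉X with ∈-++-∷⁻ xs v∈
  ... | inj₁ v∈xs        = decomposable⇒nonIsolated l v∈xs v∉X
  ... | inj₂ (inj₁ refl) = _ , ya
  ... | inj₂ (inj₂ v∈ys) = decomposable⇒nonIsolated r v∈ys v∉X

  decomposable⇒atomicCritical : Decomposable _~_ (_∈ˢ X) xs → Unique xs → (∀ v → v ∈ xs) →
                                IsAtomicMBDCritical H (∁ X)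
  decomposable⇒atomicCritical {xs} dec unq complete = record
    { critical = record
      { stallerWins   = stallerStrategy H (∁ X)
          -- The strategy expresses X as the complement of `D`. With `D` equal to `∁ X`, mapping
          -- along `id` passes through the double complement.
          (subst (Decomposable _ _) (map-id xs)
            (Decomposable-map id id id x∈p⇒x∉∁p x∉∁p⇒x∈p dec)) unq
          (λ {v} _ → lookup-replicate v nothing)
          -- The list contains all vertices, so the condition on outside neighbours is vacuous at
          -- the start.
          (λ {_} {u} _ _ _ u∉ → contradiction (complete u) u∉)
      ; dominatorWins = dominatorWins
      }
    ; independent = proj₂ isClass
    ; nonIsolated = λ v v∈ → decomposable⇒nonIsolated dec (complete v) (x∈∁p⇒x∉p v∈)
    }
    where
    dominatorWins : ∀ v → v ∉ˢ ∁ X → DominatorWins H (∁ X ∪ˢ ⁅ v ⁆)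
    dominatorWins v v∉ = PairingStrategy.dominatorWins H _ pairs unq′ adjacent covered
      where
      open NearMatching (nearMatching alternates dec (complete v) (x∉∁p⇒x∈p v∉))
      unq′ : Unique (flatten pairs)
      unq′ with _ ∷ u ← Unique-resp-↭ (setoid _) (↭⇒↭ₛ covers) unq = u
      covered : ∀ {w} → w ∉ˢ ∁ X ∪ˢ ⁅ v ⁆ → w ∈ flatten pairs
      covered {w} w∉ with ∈-resp-↭ covers (complete w)
      ... | here refl = contradiction (q⊆p∪q (∁ X) _ (x∈⁅x⁆ v)) w∉
      ... | there w∈  = w∈

-- Consecutive entries of a list.

consecutive-∈ˡ : Consecutive xs u v → u ∈ xs
consecutive-∈ˡ here      = here refl
consecutive-∈ˡ (there c) = there (consecutive-∈ˡ c)

consecutive-∈ʳ : Consecutive xs u v → v ∈ xs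
consecutive-∈ʳ here      = there (here refl)
consecutive-∈ʳ (there c) = there (consecutive-∈ʳ c)

consecutive-∈ : SymClosure (Consecutive xs) u v → u ∈ xs × v ∈ xs
consecutive-∈ (fwd c) = consecutive-∈ˡ c , consecutive-∈ʳ c
consecutive-∈ (bwd c) = consecutive-∈ʳ c , consecutive-∈ˡ c

consecutive-++ : Consecutive xs u v → Consecutive (xs ++ ys) u v
consecutive-++ here      = here
consecutive-++ (there c) = there (consecutive-++ c)

consecutive-head : Unique (x ∷ y ∷ zs) → SymClosure (Consecutive (x ∷ y ∷ zs)) x v → v ≡ y
consecutive-head unq (fwd here)      = refl
consecutive-head unq (fwd (there c)) = contradiction (consecutive-∈ˡ c) (Unique[x∷xs]⇒x∉xs unq)
consecutive-head unq (bwd here)      = refl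
consecutive-head unq (bwd (there c)) = contradiction (consecutive-∈ʳ c) (Unique[x∷xs]⇒x∉xs unq)

consecutive-tail : Unique (x ∷ zs) → u ∈ zs → v ∈ zs →
                   SymClosure (Consecutive (x ∷ zs)) u v → SymClosure (Consecutive zs) u v
consecutive-tail unq u∈ v∈ (fwd here)      = contradiction u∈ (Unique[x∷xs]⇒x∉xs unq)
consecutive-tail unq u∈ v∈ (fwd (there c)) = fwd c
consecutive-tail unq u∈ v∈ (bwd here)      = contradiction v∈ (Unique[x∷xs]⇒x∉xs unq)
consecutive-tail unq u∈ v∈ (bwd (there c)) = bwd c

-- Decomposing even paths and spiders.

data EvenLength {A : Set} : List A → Set where
  []  : EvenLength []
  two : ∀ {x y zs} → EvenLength zs → EvenLength (x ∷ y ∷ zs)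

-- The predicate `P` fixes the vertex set, while the order of the list stays hidden. Pieces can thus
-- be transported along equivalent descriptions of the same set.
record Piece {V : Set} (_~_ : Rel V 0ℓ) (InX : V → Set) (P : V → Set) : Set where
  field
    elements   : List V
    decomposed : Decomposable _~_ InX elements
    distinct   : Unique elements
    sound      : v ∈ elements → P v
    complete   : P v → v ∈ elements

module Pieces {V : Set} {_~_ : Rel V 0ℓ} {InX : V → Set} (~-sym : Symmetric _~_)
              (independent : ∀ {u v} → u ~ v → InX u → ¬ InX v)
              (alternates : ∀ {u v} → u ~ v → ¬ InX u → InX v) where

  open Piece

  singlePiece : InX x → Piece _~_ InX (_∈ x ∷ [])
  singlePiece x∈X = record
    { elements = _ ; decomposed = single x∈X ; distinct = [] ∷ [] ; sound = id ; complete = id }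

  relabel : ∀ {P Q} → (∀ {v} → P v → Q v) → (∀ {v} → Q v → P v) → Piece _~_ InX P → Piece _~_ InX Q
  relabel P⇒Q Q⇒P p = record
    { elements = elements p ; decomposed = decomposed p ; distinct = distinct p
    ; sound = P⇒Q ∘ sound p ; complete = complete p ∘ Q⇒P }

  joinPieces : ∀ {P Q : V → Set} {y a b} → ¬ InX y → P a → y ~ a → Q b → y ~ b →
               (∀ {u v} → P u → Q v → ¬ (u ~ v)) → ¬ P y → ¬ Q y → (∀ {v} → P v → ¬ Q v) →
               Piece _~_ InX P → Piece _~_ InX Q → Piece _~_ InX (λ v → P v ⊎ v ≡ y ⊎ Q v)
  joinPieces y∉X Pa ya Qb yb sep ¬Py ¬Qy disj p q = record
    { elements   = elements p ++ _ ∷ elements q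
    ; decomposed = join y∉X (complete p Pa) ya (complete q Qb) yb
                     (λ u∈ v∈ → sep (sound p u∈) (sound q v∈)) (decomposed p) (decomposed q)
    ; distinct   = Unique-++⁺ (distinct p)
                     (tabulateAll (λ { v∈ refl → ¬Qy (sound q v∈) }) ∷ distinct q)
                     λ { (v∈p , here refl) → ¬Py (sound p v∈p)
                       ; (v∈p , there v∈q) → disj (sound p v∈p) (sound q v∈q) }
    ; sound      = λ v∈ → case ∈-++-∷⁻ (elements p) v∈ of λ where
                     (inj₁ v∈p)        → inj₁ (sound p v∈p)
                     (inj₂ (inj₁ eq))  → inj₂ (inj₁ eq)
                     (inj₂ (inj₂ v∈q)) → inj₂ (inj₂ (sound q v∈q))
    ; complete   = λ where
                     (inj₁ Pv)          → ∈-++⁺ˡ (complete p Pv)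
                     (inj₂ (inj₁ refl)) → ∈-insert (elements p)
                     (inj₂ (inj₂ Qv))   → ∈-++⁺ʳ (elements p) (there (complete q Qv))
    }

  -- The second vertex `y` joins `{x}` to the path starting at `z`, and alternation puts `z` in X
  -- again. The list `ws` continues the path beyond the piece; for an arm it consists of the tip, so
  -- that facts about the full path apply directly.
  pathPiece : EvenLength zs → InX x → Unique (x ∷ zs ++ ws) →
              (∀ {u v} → u ∈ x ∷ zs → v ∈ x ∷ zs → u ~ v →
                 SymClosure (Consecutive (x ∷ zs ++ ws)) u v) →
              (∀ {u v} → Consecutive (x ∷ zs) u v → u ~ v) →
              Piece _~_ InX (_∈ x ∷ zs)
  pathPiece [] x∈X unq _ _ = singlePiece x∈X
  pathPiece {x = x} (two {y} {z} {zs} even) x∈X unq@(x≢ ∷ unq′@(y≢ ∷ unq″)) consec adj =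
    relabel (λ { (inj₁ (here refl)) → here refl
               ; (inj₂ (inj₁ refl)) → there (here refl)
               ; (inj₂ (inj₂ v∈)) → there (there v∈) })
            (λ { (here refl) → inj₁ (here refl)
               ; (there (here refl)) → inj₂ (inj₁ refl)
               ; (there (there v∈)) → inj₂ (inj₂ v∈) })
      (joinPieces y∉X (here refl) (~-sym (adj here)) (here refl) (adj (there here))
        -- The only neighbour of `x` on the path is `y`, which does not recur in `z ∷ zs`.
        (λ { (here refl) v∈ xv → y∉ (subst (_∈ z ∷ zs)
               (consecutive-head unq (consec (here refl) (there (there v∈)) xv)) v∈) })
        (λ { (here refl) → x∉ (here refl) }) y∉
        (λ { (here refl) x∈ → x∉ (there (∈-++⁺ˡ x∈)) })
        (singlePiece x∈X)
        (pathPiece even (alternates (adj (there here)) y∉X) unq″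
          (λ u∈ v∈ uv → consecutive-tail unq′ (∈-++⁺ˡ u∈) (∈-++⁺ˡ v∈)
             (consecutive-tail unq (there (∈-++⁺ˡ u∈)) (there (∈-++⁺ˡ v∈))
               (consec (there (there u∈)) (there (there v∈)) uv)))
          (λ c → adj (there (there c)))))
    where
    x∉ = Unique[x∷xs]⇒x∉xs unq
    y∉ : y ∉ z ∷ zs
    y∉ y∈ = Unique[x∷xs]⇒x∉xs unq′ (∈-++⁺ˡ y∈)
    y∉X : ¬ InX y
    y∉X = independent (adj here) x∈X

  -- Membership in X alternates along the path, and the number of steps from `x` to `y` is odd.
  even-path-end : EvenLength zs → InX x →
                  (∀ {u v} → Consecutive (x ∷ zs ++ y ∷ []) u v → u ~ v) → ¬ InX y
  even-path-end []         x∈X adj = independent (adj here) x∈X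
  even-path-end (two even) x∈X adj =
    even-path-end even (alternates (adj (there here)) (independent (adj here) x∈X))
      (λ c → adj (there (there c)))

  -- An arm consists of the vertices strictly between its root and its tip. The tip, later a
  -- midpoint, occurs in the hypotheses but stays outside the spider.
  module Arms {Arm : Set} (root tip : Arm → V) (arm : Arm → List V)
    (arm-even     : ∀ a → EvenLength (arm a))
    (arm-unique   : ∀ a → Unique (root a ∷ arm a ++ tip a ∷ []))
    (arm-adj      : ∀ a {u v} → Consecutive (root a ∷ arm a) u v → u ~ v)
    (arm-adj⁻     : ∀ a {u v} → u ∈ arm a → u ~ v →
                    SymClosure (Consecutive (root a ∷ arm a ++ tip a ∷ [])) u v)
    (arm-disjoint : ∀ {a a′ v} → v ∈ arm a → v ∈ arm a′ → a ≡ a′)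
    (tip∉arm      : ∀ a a′ → tip a ∉ arm a′)
    (r : V) (r∈X : InX r) where

    InSpider : List Arm → V → Set
    InSpider as v = v ≡ r ⊎ ∃[ a ] (a ∈ as × v ∈ arm a)

    root∉arm : ∀ a → root a ∉ arm a
    root∉arm a v∈ = Unique[x∷xs]⇒x∉xs (arm-unique a) (∈-++⁺ˡ v∈)

    -- Arms are attached one at a time. The first vertex `y` of a nonempty arm joins the spider
    -- built so far to the rest of the arm, an even path starting in X; an empty arm changes
    -- nothing.
    spiderPiece : ∀ as → Unique as → (∀ {a} → a ∈ as → root a ≡ r) → Piece _~_ InX (InSpider as)
    spiderPiece [] _ _ = relabel {P = _∈ r ∷ []}
      (λ { (here eq) → inj₁ eq }) (λ { (inj₁ eq) → here eq }) (singlePiece r∈X)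
    spiderPiece (a ∷ as) unq@(_ ∷ unq′) rooted with refl ← rooted (here refl) =
      attach (arm a) refl (arm-even a)
      where
      body = spiderPiece as unq′ (rooted ∘ there)
      a∉as = Unique[x∷xs]⇒x∉xs unq
      disjoint : ∀ {v} → v ∈ arm a → ¬ InSpider as v
      disjoint v∈ (inj₁ refl) = root∉arm a v∈
      disjoint v∈ (inj₂ (a′ , a′∈ , v∈′)) with refl ← arm-disjoint v∈ v∈′ = a∉as a′∈
      -- The arm is generalised to `zs` so that it can be split into its first two vertices.
      attach : ∀ zs → arm a ≡ zs → EvenLength zs → Piece _~_ InX (InSpider (a ∷ as))
      attach [] eq [] = relabel
        (λ { (inj₁ e) → inj₁ e ; (inj₂ (a′ , a′∈ , v∈)) → inj₂ (a′ , there a′∈ , v∈) })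
        (λ { (inj₁ e) → inj₁ e
           ; (inj₂ (_ , here refl , v∈)) → contradiction (subst (_ ∈_) eq v∈) λ ()
           ; (inj₂ (a′ , there a′∈ , v∈)) → inj₂ (a′ , a′∈ , v∈) })
        body
      attach (y ∷ z ∷ zs) eq (two even) = relabel into outof
        (joinPieces y∉X (inj₁ refl) (~-sym ry) (here refl) yz separated
          (disjoint (in-arm (here refl))) (λ y∈ → Unique[x∷xs]⇒x∉xs unq₂ (∈-++⁺ˡ y∈))
          (λ v∈b v∈ → disjoint (in-arm (there v∈)) v∈b)
          body
          (pathPiece even (alternates yz y∉X) unq₃ consec (λ c → adj (there (there c)))))
        where
        adj : ∀ {u v} → Consecutive (r ∷ y ∷ z ∷ zs) u v → u ~ v
        adj c = arm-adj a (subst (λ ws → Consecutive (r ∷ ws) _ _) (sym eq) c)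
        ry = adj here
        yz = adj (there here)
        y∉X : ¬ InX y
        y∉X = independent ry r∈X
        in-arm : ∀ {v} → v ∈ y ∷ z ∷ zs → v ∈ arm a
        in-arm = subst (_ ∈_) (sym eq)
        unq₁ : Unique (r ∷ y ∷ z ∷ zs ++ tip a ∷ [])
        unq₁ = subst (λ ws → Unique (r ∷ ws ++ tip a ∷ [])) eq (arm-unique a)
        unq₂ : Unique (y ∷ z ∷ zs ++ tip a ∷ [])
        unq₂ with _ ∷ q ← unq₁ = q
        unq₃ : Unique (z ∷ zs ++ tip a ∷ [])
        unq₃ with _ ∷ q ← unq₂ = q
        adj⁻ : ∀ {u v} → u ∈ z ∷ zs → u ~ v →
               SymClosure (Consecutive (r ∷ y ∷ z ∷ zs ++ tip a ∷ [])) u v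
        adj⁻ u∈ uv = subst (λ ws → SymClosure (Consecutive (r ∷ ws ++ tip a ∷ [])) _ _) eq
          (arm-adj⁻ a (in-arm (there u∈)) uv)
        consec : ∀ {u v} → u ∈ z ∷ zs → v ∈ z ∷ zs → u ~ v →
                 SymClosure (Consecutive (z ∷ zs ++ tip a ∷ [])) u v
        consec u∈ v∈ uv = consecutive-tail unq₂ (∈-++⁺ˡ u∈) (∈-++⁺ˡ v∈)
          (consecutive-tail unq₁ (there (∈-++⁺ˡ u∈)) (there (∈-++⁺ˡ v∈)) (adj⁻ u∈ uv))
        -- A neighbour of `v` lies on the path of `a`. There the root has only `y` as a neighbour,
        -- and no vertex of that path, be it root, inner vertex or tip, lies in another arm.
        separated : ∀ {u v} → InSpider as u → v ∈ z ∷ zs → ¬ (u ~ v)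
        separated {u} {v} (inj₁ refl) v∈ uv =
          Unique[x∷xs]⇒x∉xs unq₂ (∈-++⁺ˡ (subst (_∈ z ∷ zs) v≡y v∈))
          where
          v≡y : v ≡ y
          v≡y with adj⁻ v∈ (~-sym uv)
          ... | fwd c = consecutive-head unq₁ (bwd c)
          ... | bwd c = consecutive-head unq₁ (fwd c)
        separated u∈@(inj₂ (a′ , a′∈ , u∈′)) v∈ uv with proj₂ (consecutive-∈ (adj⁻ v∈ (~-sym uv)))
        ... | here refl = root∉arm a′ (subst (_∈ arm a′) (sym (rooted (there a′∈))) u∈′)
        ... | there u∈P with ∈-++⁻ (y ∷ z ∷ zs) u∈P
        ...   | inj₁ u∈a = disjoint (in-arm u∈a) u∈
        ...   | inj₂ (here refl) = tip∉arm a a′ u∈′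
        into : ∀ {v} → InSpider as v ⊎ v ≡ y ⊎ v ∈ z ∷ zs → InSpider (a ∷ as) v
        into (inj₁ (inj₁ e)) = inj₁ e
        into (inj₁ (inj₂ (a′ , a′∈ , v∈))) = inj₂ (a′ , there a′∈ , v∈)
        into (inj₂ (inj₁ e)) = inj₂ (a , here refl , in-arm (here e))
        into (inj₂ (inj₂ v∈)) = inj₂ (a , here refl , in-arm (there v∈))
        outof : ∀ {v} → InSpider (a ∷ as) v → InSpider as v ⊎ v ≡ y ⊎ v ∈ z ∷ zs
        outof (inj₁ e) = inj₁ (inj₁ e)
        outof (inj₂ (a′ , there a′∈ , v∈)) = inj₁ (inj₂ (a′ , a′∈ , v∈))
        outof (inj₂ (_ , here refl , v∈)) with subst (_ ∈_) eq v∈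
        ... | here e   = inj₂ (inj₁ e)
        ... | there v∈′ = inj₂ (inj₂ v∈′)

-- Edges, paths and the closing of cycles.

module _ {n : ℕ} (G : Graph n) where
  open Graph G

  Joins : Edge G → Fin n → Fin n → Set
  Joins e u v = (Edge.src e ≡ u × Edge.tgt e ≡ v) ⊎ (Edge.src e ≡ v × Edge.tgt e ≡ u)

  edgeBetween : ∀ {u v} → u ~ v → ∃[ e ] Joins e u v
  edgeBetween {u} {v} uv with <-cmp u v
  ... | tri< u<v _ _ = edge u v u<v uv , inj₁ (refl , refl)
  ... | tri≈ _ refl _ = contradiction uv ~-irrefl
  ... | tri> _ _ v<u = edge v u v<u (~-sym uv) , inj₂ (refl , refl)

  -- The field is irrelevant; decidability of adjacency recovers a usable proof.
  edge-adjacent : (e : Edge G) → Edge.src e ~ Edge.tgt e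
  edge-adjacent (edge s t _ st) = recompute (s ~? t) st

  edge-≡ : {e e′ : Edge G} → Edge.src e ≡ Edge.src e′ → Edge.tgt e ≡ Edge.tgt e′ → e ≡ e′
  edge-≡ {edge _ _ _ _} {edge _ _ _ _} refl refl = refl

  edge-< : (e : Edge G) → Edge.src e < Edge.tgt e
  edge-< (edge s t st _) = recompute (s <? t) st

  -- Equally oriented edges agree in both endpoints; opposite orientations would give both `u < v`
  -- and `v < u`.
  joins-unique : ∀ {e e′ u v} → Joins e u v → Joins e′ u v → e ≡ e′
  joins-unique (inj₁ (p , q)) (inj₁ (p′ , q′)) = edge-≡ (trans p (sym p′)) (trans q (sym q′))
  joins-unique (inj₂ (p , q)) (inj₂ (p′ , q′)) = edge-≡ (trans p (sym p′)) (trans q (sym q′))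
  joins-unique {e} {e′} (inj₁ (refl , refl)) (inj₂ (p′ , q′)) =
    contradiction (edge-< e) (<-asym (subst₂ _<_ p′ q′ (edge-< e′)))
  joins-unique {e} {e′} (inj₂ (refl , refl)) (inj₁ (p′ , q′)) =
    contradiction (edge-< e) (<-asym (subst₂ _<_ p′ q′ (edge-< e′)))

  data Path (u v : Fin n) : List (Fin n) → Set where
    [_] : u ≡ v → Path u v (u ∷ [])
    _∷_ : ∀ {w ws} → u ~ w → Path w v ws → Path u v (u ∷ ws)

  path-∷ʳ : ∀ {u v w ws} → Path u v ws → v ~ w → Path u w (ws ++ w ∷ [])
  path-∷ʳ [ refl ]  vw = vw ∷ [ refl ]
  path-∷ʳ (uw ∷ ps) vw = uw ∷ path-∷ʳ ps vw

  path-linked : ∀ {u v ws} → Path u v ws → Linked _~_ ws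
  path-linked [ _ ] = [-]
  path-linked (uw ∷ p@([ _ ])) = uw ∷ path-linked p
  path-linked (uw ∷ p@(_ ∷ _)) = uw ∷ path-linked p

  path-long : ∀ {u v ws} → u ≢ v → Path u v ws → 2 ≤ length ws
  path-long u≢v [ u≡v ] = contradiction u≡v u≢v
  path-long u≢v (_ ∷ [ _ ]) = s≤s (s≤s z≤n)
  path-long u≢v (_ ∷ _ ∷ _) = s≤s (s≤s z≤n)

  -- Distinct ends force at least two vertices on the path, so adding `w` gives a cycle of length at
  -- least three. Acyclicity of the tree is applied in this form.
  closePath : ∀ {u v w ws} → u ≢ v → Path u v ws → Unique ws → w ∉ ws → w ~ u → w ~ v → Cycle G
  closePath {w = w} u≢v p unq w∉ wu wv = record
    { base     = w
    ; rest     = _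
    ; long     = path-long u≢v p
    ; distinct = tabulateAll (λ { x∈ refl → w∉ x∈ }) ∷ unq
    ; closed   = path-linked (wu ∷ path-∷ʳ p (~-sym wv))
    }

-- Joining the fibres along the tree.

module Blowup {m : ℕ} (T : Graph m) (isTree : IsTree T)
  {V : Set} {_~_ : Rel V 0ℓ} {InX : V → Set} (~-sym : Symmetric _~_)
  (independent : ∀ {u v} → u ~ v → InX u → ¬ InX v)
  (alternates : ∀ {u v} → u ~ v → ¬ InX u → InX v)
  (label : V → SubdivisionVertex T)
  (label-adj : ∀ {u v} → u ~ v → label u ≡ label v ⊎ SubdivisionAdj T (label u) (label v))
  (fibre : ∀ t → Piece _~_ InX (λ v → label v ≡ original t))
  (mid : Edge T → V) (label-mid : ∀ e → label (mid e) ≡ midpoint e)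
  (mid-unique : ∀ {v e} → label v ≡ midpoint e → v ≡ mid e)
  (mid∉X : ∀ e → ¬ InX (mid e))
  (mid-nbr : ∀ {t e} → Incidence T (original t) (midpoint e) →
             ∃[ u ] (label u ≡ original t × mid e ~ u))
  where

  open Graph T using () renaming (_~_ to _~ᵀ_; ~-sym to ~ᵀ-sym; ~-irrefl to ~ᵀ-irrefl)
  open Pieces {V} {_~_} {InX} ~-sym independent alternates

  -- A midpoint counts only when both ends of its edge are visited: this is the subdivision of the
  -- subgraph of `T` induced by `ts`.
  data Inside (ts : List (Fin m)) : SubdivisionVertex T → Set where
    original : ∀ {t} → t ∈ ts → Inside ts (original t)
    midpoint : ∀ {e} → Edge.src e ∈ ts → Edge.tgt e ∈ ts → Inside ts (midpoint e)

  -- The field `paths` records that the visited part is connected within itself; a second edge to a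
  -- new vertex would close one of these paths to a cycle.
  record Stage (ts : List (Fin m)) : Set where
    field
      piece : Piece _~_ InX (Inside ts ∘ label)
      paths : ∀ {s t} → s ∈ ts → t ∈ ts → ∃[ ws ] (Path T s t ws × Unique ws × All (_∈ ts) ws)

  initial : ∀ t → Stage (t ∷ [])
  initial t = record
    { piece = relabel (λ eq → subst (Inside _) (sym eq) (original (here refl)))
                      (λ ins → outof _ ins refl) (fibre t)
    ; paths = λ { (here refl) (here refl) → _ , [ refl ] , [] ∷ [] , here refl ∷ [] }
    }
    where
    outof : ∀ {v} l → Inside (t ∷ []) l → label v ≡ l → label v ≡ original t
    outof _ (original (here refl)) eq = eq
    -- Both ends would be `t`, contrary to the source being smaller than the target.
    outof _ (midpoint {e} (here p) (here q)) _ =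
      contradiction (edge-< T e) (<-irrefl (trans p (sym q)))

  -- Attaching a new leaf t of the visited subtree: acyclicity makes the edge
  -- to t the only one joining t to a visited vertex.
  extend : ∀ {ts s t} → Stage ts → s ∈ ts → t ∉ ts → s ~ᵀ t → Stage (t ∷ ts)
  extend {ts} {s} {t} stage s∈ t∉ st = record
    { piece = relabel into (λ ins → outof _ ins refl)
        (joinPieces (mid∉X e) (subst (Inside ts) (sym label-a) (original s∈)) ea label-b eb
          separated
          (λ ins → e∉ (subst (Inside ts) (label-mid e) ins))
          (λ eq → case trans (sym (label-mid e)) eq of λ ())
          (λ ins eq → t-outside (subst (Inside ts) eq ins))
          piece (fibre t))
    ; paths = paths′
    }
    where
    open Stage stage
    joined = edgeBetween T st
    e = proj₁ joined
    incidences : Incidence T (original s) (midpoint e) × Incidence T (original t) (midpoint e)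
    incidences with joined
    ... | e , inj₁ (refl , refl) = at-src e , at-tgt e
    ... | e , inj₂ (refl , refl) = at-tgt e , at-src e
    t∈e : Edge.src e ∈ ts → Edge.tgt e ∈ ts → t ∈ ts
    t∈e with joined
    ... | e , inj₁ (refl , refl) = λ _ q → q
    ... | e , inj₂ (refl , refl) = λ p _ → p
    label-a = proj₁ (proj₂ (mid-nbr (proj₁ incidences)))
    ea = proj₂ (proj₂ (mid-nbr (proj₁ incidences)))
    label-b = proj₁ (proj₂ (mid-nbr (proj₂ incidences)))
    eb = proj₂ (proj₂ (mid-nbr (proj₂ incidences)))
    e∉ : ¬ Inside ts (midpoint e)
    e∉ (midpoint p q) = t∉ (t∈e p q)
    t-outside : ¬ Inside ts (original t)
    t-outside (original t∈) = t∉ t∈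
    away : ∀ {l} → Inside ts l → ¬ SubdivisionAdj T l (original t)
    away (midpoint p q) (bwd (at-src _)) = t∉ p
    away (midpoint p q) (bwd (at-tgt _)) = t∉ q
    separated : ∀ {u v} → Inside ts (label u) → label v ≡ original t → ¬ (u ~ v)
    separated {u} ins eq uv with label-adj uv
    ... | inj₁ same = t-outside (subst (Inside ts) (trans same eq) ins)
    ... | inj₂ adj  = away ins (subst (SubdivisionAdj T (label u)) eq adj)
    -- A second visited neighbour of `t` would close a cycle with `t` and a path inside `ts`.
    only : ∀ {s′} → s′ ∈ ts → s′ ~ᵀ t → s′ ≡ s
    only {s′} s′∈ s′t with s′ ≟ s
    ... | yes eq = eq
    ... | no s′≢s with ws , p , unq , ws⊆ ← paths s′∈ s∈ = contradiction
            (closePath T s′≢s p unq (λ t∈ → t∉ (lookupAll ws⊆ t∈)) (~ᵀ-sym s′t) (~ᵀ-sym st))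
            (IsTree.acyclic isTree)
    weaken : ∀ {l} → Inside ts l → Inside (t ∷ ts) l
    weaken (original p)   = original (there p)
    weaken (midpoint p q) = midpoint (there p) (there q)
    e-inside : Inside (t ∷ ts) (midpoint e)
    e-inside with joined
    ... | _ , inj₁ (refl , refl) = midpoint (there s∈) (here refl)
    ... | _ , inj₂ (refl , refl) = midpoint (here refl) (there s∈)
    into : ∀ {v} → Inside ts (label v) ⊎ v ≡ mid e ⊎ label v ≡ original t →
           Inside (t ∷ ts) (label v)
    into (inj₁ ins) = weaken ins
    into (inj₂ (inj₁ refl)) = subst (Inside (t ∷ ts)) (sym (label-mid e)) e-inside
    into (inj₂ (inj₂ eq)) = subst (Inside (t ∷ ts)) (sym eq) (original (here refl))
    outof : ∀ {v} l → Inside (t ∷ ts) l → label v ≡ l →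
            Inside ts (label v) ⊎ v ≡ mid e ⊎ label v ≡ original t
    outof _ (original (here refl)) eq = inj₂ (inj₂ eq)
    outof _ (original (there t∈)) eq = inj₁ (subst (Inside ts) (sym eq) (original t∈))
    outof _ (midpoint (there p) (there q)) eq = inj₁ (subst (Inside ts) (sym eq) (midpoint p q))
    outof _ (midpoint {e′} (here p) (here q)) eq =
      contradiction (edge-< T e′) (<-irrefl (trans p (sym q)))
    -- One end of `e′` is `t` and the other is a visited neighbour of `t`, hence `s`. So `e′` is
    -- `e`, whose midpoint has just been added.
    outof _ (midpoint {e′} (here p) (there q)) eq = inj₂ (inj₁ (mid-unique (trans eq (cong midpoint
      (joins-unique T {e′} {e} (inj₂ (p , only q (subst (_ ~ᵀ_) p (~ᵀ-sym (edge-adjacent T e′)))))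
                               (proj₂ joined))))))
    outof _ (midpoint {e′} (there p) (here q)) eq = inj₂ (inj₁ (mid-unique (trans eq (cong midpoint
      (joins-unique T {e′} {e} (inj₁ (only p (subst (_ ~ᵀ_) q (edge-adjacent T e′)) , q))
                               (proj₂ joined))))))
    paths′ : ∀ {x y} → x ∈ t ∷ ts → y ∈ t ∷ ts →
             ∃[ ws ] (Path T x y ws × Unique ws × All (_∈ t ∷ ts) ws)
    paths′ (here refl) (here refl) = _ , [ refl ] , [] ∷ [] , here refl ∷ []
    paths′ (here refl) (there y∈) with ws , p , unq , ws⊆ ← paths s∈ y∈ =
      _ , ~ᵀ-sym st ∷ p , mapAll (λ { w∈ refl → t∉ w∈ }) ws⊆ ∷ unq , here refl ∷ mapAll there ws⊆
    paths′ (there x∈) (here refl) with ws , p , unq , ws⊆ ← paths x∈ s∈ =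
      _ , path-∷ʳ T p st
        , Unique-++⁺ unq ([] ∷ []) (λ { (w∈ , here refl) → t∉ (lookupAll ws⊆ w∈) })
        , All-++⁺ (mapAll there ws⊆) (here refl ∷ [])
    paths′ (there x∈) (there y∈) with ws , p , unq , ws⊆ ← paths x∈ y∈ =
      ws , p , unq , mapAll there ws⊆

  -- Along a walk each next vertex is either visited already or attached as a new leaf. The
  -- inclusion of `ts` in `ts′` lets several walks be processed in turn.
  reach : ∀ {ts s t} → Stage ts → s ∈ ts → Star _~ᵀ_ s t →
          ∃[ ts′ ] (Stage ts′ × t ∈ ts′ × (∀ {r} → r ∈ ts → r ∈ ts′))
  reach stage s∈ ε = _ , stage , s∈ , id
  reach {ts} stage s∈ (_◅_ {j = w} sw walk) with member? _≟_ w ts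
  ... | yes w∈ = reach stage w∈ walk
  ... | no w∉ with ts′ , stage′ , t∈ , mono ← reach (extend stage s∈ w∉ sw) (here refl) walk =
        ts′ , stage′ , t∈ , mono ∘ there

  reachAll : ∀ {ts s} rs → Stage ts → s ∈ ts →
             ∃[ ts′ ] (Stage ts′ × All (_∈ ts′) rs × (∀ {r} → r ∈ ts → r ∈ ts′))
  reachAll [] stage s∈ = _ , stage , [] , id
  reachAll (r ∷ rs) stage s∈
    with ts₁ , stage₁ , r∈ , mono₁ ← reach stage s∈ (IsTree.connected isTree _ r)
    with ts₂ , stage₂ , rs∈ , mono₂ ← reachAll rs stage₁ (mono₁ s∈) =
    ts₂ , stage₂ , mono₂ r∈ ∷ rs∈ , mono₂ ∘ mono₁

  whole : Fin m → ∃[ vs ] (Decomposable _~_ InX vs × Unique vs × (∀ v → v ∈ vs))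
  whole root with ts , stage , all∈ , _ ← reachAll (allFin m) (initial root) (here refl) =
    elements , decomposed , distinct , λ v → complete (everything (label v))
    where
    open Stage stage
    open Piece piece
    visited : ∀ t → t ∈ ts
    visited t = lookupAll all∈ (∈-allFin t)
    everything : ∀ l → Inside ts l
    everything (original t) = original (visited t)
    everything (midpoint e) = midpoint (visited _) (visited _)

-- Reversed lists, last steps and even lengths.

consecutive-∷ʳ² : ∀ (zs : List A) → Consecutive ((zs ++ y ∷ []) ++ x ∷ []) y x
consecutive-∷ʳ² []       = here
consecutive-∷ʳ² (z ∷ zs) = there (consecutive-∷ʳ² zs)

consecutive-reverse : Consecutive xs u v → Consecutive (reverse xs) v u
consecutive-reverse (here {x} {y} {zs})
  rewrite unfold-reverse x (y ∷ zs) | unfold-reverse y zs = consecutive-∷ʳ² (reverse zs)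
consecutive-reverse (there {z = z} {zs} c)
  rewrite unfold-reverse z zs = consecutive-++ (consecutive-reverse c)

consecutive-reverse-sym : SymClosure (Consecutive xs) u v →
                          SymClosure (Consecutive (reverse xs)) u v
consecutive-reverse-sym (fwd c) = bwd (consecutive-reverse c)
consecutive-reverse-sym (bwd c) = fwd (consecutive-reverse c)

reverse-ends : ∀ (x : A) xs y → reverse (x ∷ xs ++ y ∷ []) ≡ y ∷ reverse xs ++ x ∷ []
reverse-ends x xs y = trans (unfold-reverse x (xs ++ y ∷ []))
                            (cong (_++ x ∷ []) (reverse-++ xs (y ∷ [])))

consecutive-last : ∀ (x : A) xs y → ∃[ u ] (u ∈ x ∷ xs × Consecutive (x ∷ xs ++ y ∷ []) u y)
consecutive-last x []       y = x , here refl , here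
consecutive-last x (z ∷ xs) y with u , u∈ , c ← consecutive-last z xs y = u , there u∈ , there c

evenLength : ∀ h (xs : List A) → length xs ≡ 2 * h → EvenLength xs
evenLength zero    []           _  = []
evenLength (suc h) xs eq rewrite +-suc h (h + 0) = go xs eq
  where
  go : ∀ xs → length xs ≡ suc (suc (2 * h)) → EvenLength xs
  go (_ ∷ _ ∷ xs) eq = two (evenLength h xs (suc-injective (suc-injective eq)))

-- Enumeration of the edges of a graph.

module _ {n : ℕ} (G : Graph n) where
  open Graph G

  edge-≟ : DecidableEquality (Edge G)
  edge-≟ e e′ with Edge.src e ≟ Edge.src e′ | Edge.tgt e ≟ Edge.tgt e′
  ... | yes p | yes q = yes (edge-≡ G p q)
  ... | no ¬p | _     = no λ { refl → ¬p refl }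
  ... | _     | no ¬q = no λ { refl → ¬q refl }

  edgesFrom : Fin n × Fin n → List (Edge G)
  edgesFrom (u , v) with u <? v | u ~? v
  ... | yes u<v | yes uv = edge u v u<v uv ∷ []
  ... | _       | _      = []

  ∈-edgesFrom : ∀ e → e ∈ edgesFrom (Edge.src e , Edge.tgt e)
  ∈-edgesFrom e with Edge.src e <? Edge.tgt e | Edge.src e ~? Edge.tgt e
  ... | yes _  | yes _ = here refl
  ... | no ¬<  | _     = contradiction (edge-< G e) ¬<
  ... | yes _  | no ¬~ = contradiction (edge-adjacent G e) ¬~

  edges : List (Edge G)
  edges = concatMap edgesFrom (cartesianProduct (allFin n) (allFin n))

  ∈-edges : ∀ e → e ∈ edges
  ∈-edges e = ∈-concatMap⁺ edgesFrom
    (lose (∈-cartesianProduct⁺ (∈-allFin _) (∈-allFin _)) (∈-edgesFrom e))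

-- Passing between a graph and its abstract description.

module _ {n} {G : Graph n} {A : Set} {R : Rel A 0ℓ} (r : Realises G R) where
  open Realises r
  open Graph G

  from-to : ∀ a → from (to a) ≡ a
  from-to a = Inverse.strictlyInverseʳ bijection a

  to-from : ∀ v → to (from v) ≡ v
  to-from v = Inverse.strictlyInverseˡ bijection v

  to-injective : ∀ {a b} → to a ≡ to b → a ≡ b
  to-injective {a} {b} eq = trans (sym (from-to a)) (trans (cong from eq) (from-to b))

  realised-adjacency⁻ : ∀ {u v} → u ~ v → R (from u) (from v)
  realised-adjacency⁻ uv = Equivalence.from (adjacency _ _)
    (subst₂ _~_ (sym (to-from _)) (sym (to-from _)) uv)

element : ∀ {m} → NonZero m → Fin m
element {suc _} _ = zero

-- Arms and labels of an F-cactus.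

module Cactus {k : ℕ} (H : Graph k) (H∈𝒞 : H ∈𝒞) (X : Subset k) (isX : IsX H∈𝒞 X) where
  open _∈𝒞 H∈𝒞 using (F; F∈𝒮; cactus)
  open _∈𝒮 F∈𝒮
  open _IsCactusOver_ cactus
  open Replacement F half
  open Realises subdivision using () renaming (to to toF; from to fromS)
  open Realises replacement using (to; from; adjacency)

  -- Source and target of `f` are ordered by vertex number, which does not tell which of them is an
  -- original vertex and which a midpoint. This record does.
  record Orientation (f : Edge F) : Set where
    field
      owner     : Fin order
      end       : Edge T
      incidence : Incidence T (original owner) (midpoint end)
      joins     : Joins F f (toF (original owner)) (toF (midpoint end))

  orientation : ∀ f → Orientation f
  orientation f = orient (realised-adjacency⁻ subdivision (edge-adjacent F f)) refl refl
    where
    orient : ∀ {a b} → SubdivisionAdj T a b →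
             fromS (Edge.src f) ≡ a → fromS (Edge.tgt f) ≡ b → Orientation f
    back : ∀ {v a} → fromS v ≡ a → v ≡ toF a
    back refl = sym (to-from subdivision _)
    orient (fwd i@(at-src _)) p q = record { incidence = i ; joins = inj₁ (back p , back q) }
    orient (fwd i@(at-tgt _)) p q = record { incidence = i ; joins = inj₁ (back p , back q) }
    orient (bwd i@(at-src _)) p q = record { incidence = i ; joins = inj₂ (back p , back q) }
    orient (bwd i@(at-tgt _)) p q = record { incidence = i ; joins = inj₂ (back p , back q) }

  module _ (f : Edge F) where
    open Orientation (orientation f) public

  -- One arm for each of the two paths replacing an edge; a path of length one has an empty arm.
  Arm : Set
  Arm = Edge F × Bool

  root tip : Arm → Vertex
  root (f , _) = old (toF (original (owner f)))
  tip  (f , _) = old (toF (midpoint (end f)))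

  interior : Arm → List Vertex
  interior (f , s) = tabulate (new f s)

  -- Always listed from the original vertex towards the midpoint, hence reversed when the source of
  -- the edge is the midpoint.
  arm : Arm → List Vertex
  arm a@(f , s) = [ (λ _ → interior a) , (λ _ → reverse (interior a)) ]′ (joins f)

  armPath : Arm → List Vertex
  armPath a = root a ∷ arm a ++ tip a ∷ []

  armPath-oriented : ∀ a → armPath a ≡ path (proj₁ a) (proj₂ a)
                   ⊎ armPath a ≡ reverse (path (proj₁ a) (proj₂ a))
  armPath-oriented (f , s) with joins f
  ... | inj₁ (p , q) = inj₁ (sym (withEnds p q))
    where
    withEnds : ∀ {u v} → Edge.src f ≡ u → Edge.tgt f ≡ v →
               path f s ≡ old u ∷ interior (f , s) ++ old v ∷ []
    withEnds refl refl = refl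
  ... | inj₂ (p , q) = inj₂ (sym (withEnds p q))
    where
    withEnds : ∀ {u v} → Edge.src f ≡ u → Edge.tgt f ≡ v →
               reverse (path f s) ≡ old v ∷ reverse (interior (f , s)) ++ old u ∷ []
    withEnds refl refl = reverse-ends _ (interior (f , s)) _

  armPath-↭ : ∀ a → path (proj₁ a) (proj₂ a) ↭ armPath a
  armPath-↭ a with armPath-oriented a
  ... | inj₁ eq rewrite eq = ↭-refl
  ... | inj₂ eq rewrite eq = ↭-sym (↭-reverse _)

  armPath-consecutive : ∀ a {u v} → SymClosure (Consecutive (path (proj₁ a) (proj₂ a))) u v →
                        SymClosure (Consecutive (armPath a)) u v
  armPath-consecutive a c with armPath-oriented a
  ... | inj₁ eq rewrite eq = c
  ... | inj₂ eq rewrite eq = consecutive-reverse-sym c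

  armPath-consecutive⁻ : ∀ a {u v} → SymClosure (Consecutive (armPath a)) u v →
                         SymClosure (Consecutive (path (proj₁ a) (proj₂ a))) u v
  armPath-consecutive⁻ a {u} {v} c with armPath-oriented a
  ... | inj₁ eq rewrite eq = c
  ... | inj₂ eq rewrite eq = subst (λ ws → SymClosure (Consecutive ws) u v)
                               (reverse-involutive _) (consecutive-reverse-sym c)

  arm-↭ : ∀ a → interior a ↭ arm a
  arm-↭ a@(f , s) with joins f
  ... | inj₁ _ = ↭-refl
  ... | inj₂ _ = ↭-sym (↭-reverse _)

  ∈-arm⁺ : ∀ f s i → new f s i ∈ arm (f , s)
  ∈-arm⁺ f s i = ∈-resp-↭ (arm-↭ (f , s)) (∈-tabulate⁺ i)

  ∈-arm⁻ : ∀ {v} a → v ∈ arm a → ∃[ i ] v ≡ new (proj₁ a) (proj₂ a) i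
  ∈-arm⁻ a v∈ = ∈-tabulate⁻ (∈-resp-↭ (↭-sym (arm-↭ a)) v∈)

  new∈path : ∀ {f s i} f′ s′ → new f s i ∈ path f′ s′ → (f , s) ≡ (f′ , s′)
  new∈path f′ s′ (there v∈) with ∈-++⁻ (tabulate (new f′ s′)) v∈
  ... | inj₁ v∈′ with _ , refl ← ∈-tabulate⁻ v∈′ = refl
  ... | inj₂ (here ())

  arm-even : ∀ a → EvenLength (arm a)
  arm-even (f , s) with joins f
  ... | inj₁ _ = evenLength (half f s) _ (length-tabulate _)
  ... | inj₂ _ = evenLength (half f s) _
                   (trans (length-reverse (interior (f , s))) (length-tabulate _))

  path-unique : ∀ f s → Unique (path f s)
  path-unique f s =
    tabulateAll (λ { v∈ refl → case ∈-++⁻ (tabulate (new f s)) v∈ of λ where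
                     (inj₁ v∈′)         → case ∈-tabulate⁻ v∈′ of λ ()
                     (inj₂ (here e)) → <-irrefl (old-injective e) (edge-< F f) })
    ∷ Unique-++⁺ (Unique-tabulate⁺ λ { refl → refl }) ([] ∷ [])
        λ { (v∈ , here refl) → case ∈-tabulate⁻ v∈ of λ () }
    where
    old-injective : ∀ {u v} → old u ≡ old v → u ≡ v
    old-injective refl = refl

  arm-unique : ∀ a → Unique (armPath a)
  arm-unique a@(f , s) = Unique-resp-↭ (setoid _) (↭⇒↭ₛ (armPath-↭ a)) (path-unique f s)

  arm-path-adj : ∀ a {u v} → SymClosure (Consecutive (armPath a)) u v → Adj u v
  arm-path-adj a@(f , s) c with armPath-consecutive⁻ a c
  ... | fwd c = fwd (step f s c)
  ... | bwd c = bwd (step f s c)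

  arm-adj : ∀ a {u v} → Consecutive (root a ∷ arm a) u v → Adj u v
  arm-adj a c = arm-path-adj a (fwd (consecutive-++ c))

  -- A `new` vertex carries its edge and side as indices and so lies on no other path. Every step
  -- involving it is a step of that path.
  arm-adj⁻ : ∀ a {u v} → u ∈ arm a → Adj u v → SymClosure (Consecutive (armPath a)) u v
  arm-adj⁻ a u∈ uv with ∈-arm⁻ a u∈
  arm-adj⁻ a u∈ (fwd (step f s c)) | i , refl with refl ← new∈path f s (consecutive-∈ˡ c) =
    armPath-consecutive a (fwd c)
  arm-adj⁻ a u∈ (bwd (step f s c)) | i , refl with refl ← new∈path f s (consecutive-∈ʳ c) =
    armPath-consecutive a (bwd c)

  arm-disjoint : ∀ {a a′ v} → v ∈ arm a → v ∈ arm a′ → a ≡ a′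
  arm-disjoint {a} {a′} v∈ v∈′ with ∈-arm⁻ a v∈ | ∈-arm⁻ a′ v∈′
  ... | _ , refl | _ , refl = refl

  tip∉arm : ∀ a a′ → tip a ∉ arm a′
  tip∉arm a a′ v∈ with ∈-arm⁻ a′ v∈
  ... | _ , ()

  -- Each arm is contracted to its owner, so the fibre over an original vertex is a spider and the
  -- fibre over a midpoint is one vertex.
  label : Vertex → SubdivisionVertex T
  label (old v)     = fromS v
  label (new f _ _) = original (owner f)

  label-root : ∀ a → label (root a) ≡ original (owner (proj₁ a))
  label-root a = from-to subdivision _

  label-arm : ∀ a {v} → v ∈ root a ∷ arm a → label v ≡ original (owner (proj₁ a))
  label-arm a (here refl) = label-root a
  label-arm a (there v∈) with _ , refl ← ∈-arm⁻ a v∈ = refl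

  label-armPath : ∀ a {v} → v ∈ armPath a →
                  label v ≡ original (owner (proj₁ a)) ⊎ label v ≡ midpoint (end (proj₁ a))
  label-armPath a (here refl) = inj₁ (label-root a)
  label-armPath a (there v∈) with ∈-++⁻ (arm a) v∈
  ... | inj₁ v∈′         = inj₁ (label-arm a (there v∈′))
  ... | inj₂ (here refl) = inj₂ (from-to subdivision _)

  adj-armPath : ∀ {u v} → Adj u v → ∃[ a ] (u ∈ armPath a × v ∈ armPath a)
  adj-armPath (fwd (step f s c)) = (f , s) , consecutive-∈ (armPath-consecutive (f , s) (fwd c))
  adj-armPath (bwd (step f s c)) = (f , s) , consecutive-∈ (armPath-consecutive (f , s) (bwd c))

  -- Adjacent vertices share an arm path, on which only two labels occur, and these are incident in
  -- the subdivided tree.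
  label-adj : ∀ {u v} → Adj u v → label u ≡ label v ⊎ SubdivisionAdj T (label u) (label v)
  label-adj uv with a@(f , _) , u∈ , v∈ ← adj-armPath uv =
    both (label-armPath a u∈) (label-armPath a v∈)
    where
    both : ∀ {l l′} → l ≡ original (owner f) ⊎ l ≡ midpoint (end f) →
           l′ ≡ original (owner f) ⊎ l′ ≡ midpoint (end f) → l ≡ l′ ⊎ SubdivisionAdj T l l′
    both (inj₁ refl) (inj₁ refl) = inj₁ refl
    both (inj₂ refl) (inj₂ refl) = inj₁ refl
    both (inj₁ refl) (inj₂ refl) = inj₂ (fwd (incidence f))
    both (inj₂ refl) (inj₁ refl) = inj₂ (bwd (incidence f))

  -- Spiders, midpoints and the class X.

  InX′ : Vertex → Set
  InX′ v = to v ∈ˢ X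

  isClass = IsX.isClass isX

  adj⇒ : ∀ {u v} → Adj u v → Graph._~_ H (to u) (to v)
  adj⇒ = Equivalence.to (adjacency _ _)

  adj-independent : ∀ {u v} → Adj u v → InX′ u → ¬ InX′ v
  adj-independent uv u∈ v∈ = proj₁ isClass u∈ v∈ (adj⇒ uv)

  adj-alternates : ∀ {u v} → Adj u v → ¬ InX′ u → InX′ v
  adj-alternates uv = alternates H X isClass (adj⇒ uv)

  original∈X : ∀ t → InX′ (old (toF (original t)))
  original∈X t = IsX.contains isX _ (inX t)

  open Pieces {_~_ = Adj} {InX′} (symmetric Step) adj-independent adj-alternates

  _≟ᵃ_ : DecidableEquality Arm
  _≟ᵃ_ = ×-≡-dec (edge-≟ F) _≟ᵇ_

  -- Deduplication yields the distinctness required when a spider is built arm by arm.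
  arms : List Arm
  arms = deduplicate _≟ᵃ_ (cartesianProduct (edges F) (true ∷ false ∷ []))

  ∈-arms : ∀ a → a ∈ arms
  ∈-arms (f , s) = ∈-deduplicate⁺ _≟ᵃ_ (∈-cartesianProduct⁺ (∈-edges F f) (∈-bools s))
    where
    ∈-bools : ∀ s → s ∈ true ∷ false ∷ []
    ∈-bools true  = here refl
    ∈-bools false = there (here refl)

  fibre : ∀ t → Piece Adj InX′ (λ v → label v ≡ original t)
  fibre t = relabel into outof (spiderPiece armsAt unique rooted)
    where
    open Arms root tip arm arm-even arm-unique arm-adj arm-adj⁻ arm-disjoint tip∉arm
              (old (toF (original t))) (original∈X t)
    at? : ∀ (a : Arm) → Dec (owner (proj₁ a) ≡ t)
    at? a = owner (proj₁ a) ≟ t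
    armsAt = filter at? arms
    unique = Unique-filter⁺ at? (deduplicate-! _≟ᵃ_ (cartesianProduct (edges F) (true ∷ false ∷ [])))
    rooted : ∀ {a} → a ∈ armsAt → root a ≡ old (toF (original t))
    rooted a∈ = cong (old ∘ toF ∘ original) (proj₂ (∈-filter⁻ at? {xs = arms} a∈))
    into : ∀ {v} → InSpider armsAt v → label v ≡ original t
    into (inj₁ refl) = from-to subdivision _
    into (inj₂ (a , a∈ , v∈)) = trans (label-arm a (there v∈))
                                      (cong original (proj₂ (∈-filter⁻ at? {xs = arms} a∈)))
    outof : ∀ {v} → label v ≡ original t → InSpider armsAt v
    outof {old v} eq = inj₁ (cong old (trans (sym (to-from subdivision v)) (cong toF eq)))
    outof {new f s i} refl = inj₂ ((f , s) , ∈-filter⁺ at? (∈-arms _) refl , ∈-arm⁺ f s i)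

  mid : Edge T → Vertex
  mid e = old (toF (midpoint e))

  mid-unique : ∀ {v e} → label v ≡ midpoint e → v ≡ mid e
  mid-unique {old v} eq = cong old (trans (sym (to-from subdivision v)) (cong toF eq))

  -- If the two orientations of `f` were opposite, an original vertex would coincide with a
  -- midpoint.
  joins-owner : ∀ {f t e} → Joins F f (toF (original t)) (toF (midpoint e)) → owner f ≡ t × end f ≡ e
  joins-owner {f} j with joins f
  joins-owner (inj₁ (p , q)) | inj₁ (p′ , q′)
    with refl ← to-injective subdivision (trans (sym p′) p)
       | refl ← to-injective subdivision (trans (sym q′) q) = refl , refl
  joins-owner (inj₂ (p , q)) | inj₂ (p′ , q′)
    with refl ← to-injective subdivision (trans (sym p′) p)
       | refl ← to-injective subdivision (trans (sym q′) q) = refl , refl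
  joins-owner (inj₁ (p , q)) | inj₂ (p′ , q′) with () ← to-injective subdivision (trans (sym p′) p)
  joins-owner (inj₂ (p , q)) | inj₁ (p′ , q′) with () ← to-injective subdivision (trans (sym p′) p)

  armBetween : ∀ {t e} → Incidence T (original t) (midpoint e) →
               ∃[ f ] (owner f ≡ t × end f ≡ e)
  armBetween inc
    with f , j ← edgeBetween F (Equivalence.to (Realises.adjacency subdivision _ _) (fwd inc)) =
    f , joins-owner {f} j

  mid-nbr : ∀ {t e} → Incidence T (original t) (midpoint e) →
            ∃[ u ] (label u ≡ original t × Adj (mid e) u)
  mid-nbr inc
    with f , refl , refl ← armBetween inc
    -- The last vertex before the tip serves, which is the root when the arm is empty. The side
    -- `true` is an arbitrary choice.
    with u , u∈ , c ← consecutive-last (root (f , true)) (arm (f , true)) (tip (f , true)) =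
    u , label-arm (f , true) u∈ , arm-path-adj (f , true) (bwd c)

  -- `IsX` places only the original vertices; a midpoint is reached from one of them by a path of
  -- odd length.
  mid∉X : ∀ e → ¬ InX′ (mid e)
  mid∉X e with f , _ , refl ← armBetween (at-src e) =
    even-path-end (arm-even (f , true)) (original∈X _) (λ c → arm-path-adj (f , true) (fwd c))

  open Blowup T isTree (symmetric Step) adj-independent adj-alternates label label-adj fibre
              mid (λ e → from-to subdivision _) mid-unique mid∉X mid-nbr

  atomicCritical : IsAtomicMBDCritical H (∁ X)
  atomicCritical with vs , dec , unq , complete ← whole (element (IsTree.nonEmpty isTree)) =
    decomposable⇒atomicCritical H X isClass
      -- The decomposition was built on the abstract vertices and is carried to `H` by the renaming
      -- `to`.
      (Decomposable-map to adj⇒ (Equivalence.from (adjacency _ _)) id id dec)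
      (Unique-map⁺ (to-injective replacement) unq)
      (λ v → subst (_∈ map to vs) (to-from replacement v) (∈-map⁺ to (complete (from v))))

theorem5p2 : ∀ {k : ℕ} (H : Graph k) (H∈𝒞 : H ∈𝒞) (X : Subset k) → IsX H∈𝒞 X →
    IsAtomicMBDCritical H (∁ X)
theorem5p2 = Cactus.atomicCritical
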